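{- Let $n\ge 1$ and $w\in S_n$. Then, as an identity in $\mathbb Z[\beta^{\pm1}][x_1,\dots,x_n;y_1,\dots,y_n]$, $$\mathfrak G^{(\beta)}_w(\mathbf x;\mathbf y)=\beta^{ -\ell(w)}\sum_{\mathcal P\in \mathsf{Pipes}(w)}\mathrm{wt}(\mathcal P).$$
   Context: Permutations $w\in S_n$ are written in one-line notation $w=w_1\cdots w_n$, $w_i=w(i)$; $s_i$ is the transposition $(i\ i+1)$; $\ell(w)$ is the Coxeter length (number of inversions); $w_0=n\,(n-1)\cdots 1$. Bumpless pipe dreams. Cells of the $n\times n$ grid are indexed $(i,j)$: row $i$ from the top, column $j$ from the left. There are six tiles: downward elbow (a pipe joining the bottom and right edges), upward elbow (a pipe joining the left and top edges), crossing (one pipe joining left and right edges and one joining bottom and top edges), blank (no pipe), horizontal (a pipe joining left and right edges), vertical (a pipe joining bottom and top edges). A bumpless pipe dream (BPD) of size $n$ is a tiling of the $n\times n$ grid by these tiles such that an edge shared by two cells is met by a pipe from both sides or from neither, every edge on the bottom boundary and every edge on the right boundary of the grid is met by a pipe, and no edge on the left or top boundary is met by a pipe. Thus there are $n$ pipes, each running from the bottom boundary to the right boundary moving north and east. $D(\mathcal P)$ is the set of positions $(i,j)$ of blank tiles of $\mathcal P$ and $U(\mathcal P)$ is the set of positions of upward elbow tiles. Demazure product $\partial(\mathcal P)\in S_n$ of a BPD $\mathcal P$: label the bottom boundary edges $1,\dots,n$ from left to right and propagate labels along pipes north and east; at a crossing tile, of the two labels entering from the left and from below, the smaller one leaves through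 the right edge and the larger one through the top edge. Then $\partial(\mathcal P)(i)$ is the label arriving at the right boundary edge of row $i$. $\mathsf{Pipes}(w)$ is the set of BPDs $\mathcal P$ of size $n$ with $\partial(\mathcal P)=w$. Weights: $x_i\oplus y_j=x_i+y_j+\beta x_iy_j$ and $$\mathrm{wt}(\mathcal P)=\Big(\prod_{(i,j)\in D(\mathcal P)}\beta(x_i\oplus y_j)\Big)\Big(\prod_{(i,j)\in U(\mathcal P)}\big(1+\beta(x_i\oplus y_j)\big)\Big).$$ $\beta$-double Grothendieck polynomials: $S_n$ acts on $\mathbb Z[\beta][y_1,\dots,y_n][x_1,\dots,x_n]$ by permuting the $x$ variables, $w\cdot f=f(x_{w_1},\dots,x_{w_n};\mathbf y)$. Let $\pi_i(f)=\dfrac{(1+\beta x_{i+1})f-(1+\beta x_i)\,s_i\cdot f}{x_i-x_{i+1}}$. Set $\mathfrak G^{(\beta)}_{w_0}(\mathbf x;\mathbf y)=\prod_{i,j\ge1,\ i+j\le n}(x_i\oplus y_j)$, and whenever $w_i>w_{i+1}$ set $\mathfrak G^{(\beta)}_{ws_i}(\mathbf x;\mathbf y)=\pi_i(\mathfrak G^{(\beta)}_w(\mathbf x;\mathbf y))$; this is well defined since the $\pi_i$ satisfy the braid and commutation relations. -}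

module Defs where

open import Algebra.Bundles using (CommutativeRing)
open import Data.Bool using (Bool; true; false; if_then_else_)
import Data.Bool.Properties as Bool
open import Data.Fin using (Fin; zero; suc; toℕ; opposite)
import Data.Fin as Fin
import Data.Fin.Properties as Fin
import Data.Fin.Induction as Fin
open import Data.Fin.Permutation as Perm
  using (Permutation′; _⟨$⟩ʳ_; _∘ₚ_; transpose; reverse)
open import Data.List using (List; []; _∷_; foldr; map; filter; length; allFin;
  cartesianProduct; cartesianProductWith)
open import Data.Maybe using (Maybe; just; nothing; zipWith)
import Data.Maybe.Properties as Maybe
open import Data.Nat using (ℕ; zero; suc)
import Data.Nat as ℕ
import Data.Nat.Properties as ℕ
open import Data.Product using (∃; _×_; _,_; proj₁; proj₂)
open import Data.Vec using (Vec; []; _∷_; lookup; tabulate)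
open import Function using (_∘_)
open import Function.Bundles using (Injection)
open import Function.Properties.Inverse using (↔⇒↣)
open import Induction.WellFounded using (Acc; acc)
open import Level using (0ℓ)
open import Relation.Binary.PropositionalEquality as ≡ using (_≡_; _≢_)
open import Relation.Nullary using (¬_; Dec; yes; no; does; contradiction)
open import Relation.Nullary.Decidable using (_×-dec_; _→-dec_; map′; dec-true; dec-false)
open import Relation.Unary using (Decidable)

private
  variable
    n : ℕ

-- The ring ℤ[β^{±1}][x₁,…,xₙ; y₁,…,yₙ], presented as the free commutative ring
-- on β, β⁻¹, the xᵢ and the yⱼ modulo the relation β β⁻¹ = 1: terms, with
-- equality the least congruence containing the commutative ring axioms and
-- that relation.  Variables are indexed from 0.

infix  4 _≈_
infixl 6 _+_ _-_ _⊕_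
infixl 7 _*_
infix  8 -_
infixr 8 _^_

data Poly (n : ℕ) : Set where
  0# 1#   : Poly n
  β β⁻¹   : Poly n
  x y     : Fin n → Poly n
  _+_ _*_ : Poly n → Poly n → Poly n
  -_      : Poly n → Poly n

data _≈_ {n : ℕ} : Poly n → Poly n → Set where
  ≈-refl      : ∀ {f} → f ≈ f
  ≈-sym       : ∀ {f g} → f ≈ g → g ≈ f
  ≈-trans     : ∀ {f g h} → f ≈ g → g ≈ h → f ≈ h
  +-cong      : ∀ {f f′ g g′} → f ≈ f′ → g ≈ g′ → f + g ≈ f′ + g′
  *-cong      : ∀ {f f′ g g′} → f ≈ f′ → g ≈ g′ → f * g ≈ f′ * g′
  -‿cong      : ∀ {f f′} → f ≈ f′ → - f ≈ - f′
  +-assoc     : ∀ f g h → (f + g) + h ≈ f + (g + h)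
  +-comm      : ∀ f g → f + g ≈ g + f
  +-identityˡ : ∀ f → 0# + f ≈ f
  -‿inverseˡ  : ∀ f → - f + f ≈ 0#
  *-assoc     : ∀ f g h → (f * g) * h ≈ f * (g * h)
  *-comm      : ∀ f g → f * g ≈ g * f
  *-identityˡ : ∀ f → 1# * f ≈ f
  distribˡ    : ∀ f g h → f * (g + h) ≈ f * g + f * h
  β-inverse   : β * β⁻¹ ≈ 1#

polyRing : ℕ → CommutativeRing 0ℓ 0ℓ
polyRing n = record
  { Carrier = Poly n ; _≈_ = _≈_ ; _+_ = _+_ ; _*_ = _*_ ; -_ = -_ ; 0# = 0# ; 1# = 1#
  ; isCommutativeRing = record
    { isRing = record
      { +-isAbelianGroup = record
        { isGroup = record
          { isMonoid = record
            { isSemigroup = record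
              { isMagma = record
                { isEquivalence = record { refl = ≈-refl ; sym = ≈-sym ; trans = ≈-trans }
                ; ∙-cong = +-cong }
              ; assoc = +-assoc }
            ; identity = +-identityˡ , λ f → ≈-trans (+-comm f 0#) (+-identityˡ f) }
          ; inverse = -‿inverseˡ , λ f → ≈-trans (+-comm f (- f)) (-‿inverseˡ f)
          ; ⁻¹-cong = -‿cong }
        ; comm = +-comm }
      ; *-cong = *-cong
      ; *-assoc = *-assoc
      ; *-identity = *-identityˡ , λ f → ≈-trans (*-comm f 1#) (*-identityˡ f)
      ; distrib = distribˡ , λ f g h → ≈-trans (*-comm (g + h) f)
          (≈-trans (distribˡ f g h) (+-cong (*-comm f g) (*-comm f h))) }
    ; *-comm = *-comm } }

_-_ : Poly n → Poly n → Poly n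
f - g = f + - g

_⊕_ : Poly n → Poly n → Poly n
f ⊕ g = f + g + β * f * g

_^_ : Poly n → ℕ → Poly n
f ^ zero  = 1#
f ^ suc k = f * f ^ k

∑ ∏ : List (Poly n) → Poly n
∑ = foldr _+_ 0#
∏ = foldr _*_ 1#

-- The endomorphism xₖ ↦ σ k fixing β and the yⱼ.
substX : (Fin n → Poly n) → Poly n → Poly n
substX σ 0#      = 0#
substX σ 1#      = 1#
substX σ β       = β
substX σ β⁻¹     = β⁻¹
substX σ (x k)   = σ k
substX σ (y k)   = y k
substX σ (f + g) = substX σ f + substX σ g
substX σ (f * g) = substX σ f * substX σ g
substX σ (- f)   = - substX σ f

_·_ : Permutation′ n → Poly n → Poly n
w · f = substX (λ k → x (w ⟨$⟩ʳ k)) f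

restrict : Fin n → Fin n → Poly n → Poly n
restrict i j = substX (λ k → if does (k Fin.≟ i) then x j else x k)

-- Quotient on division by xᵢ − xⱼ, the remainder being restrict i j f; see
-- division and quotient-exact.
quotient : Fin n → Fin n → Poly n → Poly n
quotient i j 0#      = 0#
quotient i j 1#      = 0#
quotient i j β       = 0#
quotient i j β⁻¹     = 0#
quotient i j (x k)   = if does (k Fin.≟ i) then 1# else 0#
quotient i j (y k)   = 0#
quotient i j (f + g) = quotient i j f + quotient i j g
quotient i j (f * g) = quotient i j f * g + restrict i j f * quotient i j g
quotient i j (- f)   = - quotient i j f

-- π i j is used only for adjacent indices j = i + 1.
π : Fin n → Fin n → Poly n → Poly n
π i j f = quotient i j ((1# + β * x j) * f - (1# + β * x i) * (transpose i j · f))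

module _ {n : ℕ} where
  open CommutativeRing (polyRing n)
    using (setoid; commutativeSemiring; ring; +-identityʳ; zeroʳ; zeroˡ; -‿inverseʳ)
  open import Algebra.Properties.Ring ring using (-‿+-comm; -‿distribʳ-*; -0#≈0#)
  open import Algebra.Solver.Ring.NaturalCoefficients.Default commutativeSemiring
    using (solve; _:+_; _:*_; _:=_)
  open import Relation.Binary.Reasoning.Setoid setoid

  private
    0+d*0 : ∀ (c d : Poly n) → c ≈ c + d * 0#
    0+d*0 c d = ≈-sym (≈-trans (+-cong ≈-refl (zeroʳ d)) (+-identityʳ c))

    a-b+b : ∀ (a b : Poly n) → a ≈ b + (a - b)
    a-b+b a b = ≈-sym (begin
      b + (a + - b)  ≈⟨ solve 3 (λ a b c → b :+ (a :+ c) := (c :+ b) :+ a) ≈-refl a b (- b) ⟩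
      (- b + b) + a  ≈⟨ +-cong (-‿inverseˡ b) ≈-refl ⟩
      0# + a         ≈⟨ +-identityˡ a ⟩
      a ∎)

  division : ∀ (i j : Fin n) f → f ≈ restrict i j f + (x i - x j) * quotient i j f
  division i j 0#  = 0+d*0 _ _
  division i j 1#  = 0+d*0 _ _
  division i j β   = 0+d*0 _ _
  division i j β⁻¹ = 0+d*0 _ _
  division i j (y k) = 0+d*0 _ _
  division i j (x k) with k Fin.≟ i
  ... | yes ≡.refl = ≈-trans (a-b+b (x k) (x j))
                       (+-cong ≈-refl (≈-sym (≈-trans (*-comm _ 1#) (*-identityˡ _))))
  ... | no _       = 0+d*0 _ _
  division i j (f + g) = ≈-trans (+-cong (division i j f) (division i j g))
    (solve 5 (λ a b d p q → (a :+ d :* p) :+ (b :+ d :* q) := (a :+ b) :+ d :* (p :+ q))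
      ≈-refl _ _ _ _ _)
  division i j (f * g) = begin
    f * g                               ≈⟨ *-cong (division i j f) ≈-refl ⟩
    (a + d * p) * g                     ≈⟨ solve 4 (λ a e p g → (a :+ e :* p) :* g := a :* g :+ e :* (p :* g)) ≈-refl a d p g ⟩
    a * g + d * (p * g)                 ≈⟨ +-cong (*-cong ≈-refl (division i j g)) ≈-refl ⟩
    a * (b + d * q) + d * (p * g)       ≈⟨ solve 6 (λ a b d p q g → a :* (b :+ d :* q) :+ d :* (p :* g)
                                             := a :* b :+ d :* (p :* g :+ a :* q)) ≈-refl a b d p q g ⟩
    a * b + d * (p * g + a * q)         ∎
    where
    a = restrict i j f
    b = restrict i j g
    p = quotient i j f
    q = quotient i j g
    d = x i - x j
  division i j (- f) = ≈-trans (-‿cong (division i j f))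
    (≈-trans (≈-sym (-‿+-comm _ _)) (+-cong ≈-refl (-‿distribʳ-* _ _)))

  substX-cong : ∀ (σ : Fin n → Poly n) {f g} → f ≈ g → substX σ f ≈ substX σ g
  substX-cong σ ≈-refl            = ≈-refl
  substX-cong σ (≈-sym e)         = ≈-sym (substX-cong σ e)
  substX-cong σ (≈-trans d e)     = ≈-trans (substX-cong σ d) (substX-cong σ e)
  substX-cong σ (+-cong d e)      = +-cong (substX-cong σ d) (substX-cong σ e)
  substX-cong σ (*-cong d e)      = *-cong (substX-cong σ d) (substX-cong σ e)
  substX-cong σ (-‿cong e)        = -‿cong (substX-cong σ e)
  substX-cong σ (+-assoc f g h)   = +-assoc _ _ _
  substX-cong σ (+-comm f g)      = +-comm _ _
  substX-cong σ (+-identityˡ f)   = +-identityˡ _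
  substX-cong σ (-‿inverseˡ f)    = -‿inverseˡ _
  substX-cong σ (*-assoc f g h)   = *-assoc _ _ _
  substX-cong σ (*-comm f g)      = *-comm _ _
  substX-cong σ (*-identityˡ f)   = *-identityˡ _
  substX-cong σ (distribˡ f g h)  = distribˡ _ _ _
  substX-cong σ β-inverse         = β-inverse

  quotient-cong : ∀ (i j : Fin n) {f g} → f ≈ g → quotient i j f ≈ quotient i j g
  quotient-cong i j ≈-refl            = ≈-refl
  quotient-cong i j (≈-sym e)         = ≈-sym (quotient-cong i j e)
  quotient-cong i j (≈-trans d e)     = ≈-trans (quotient-cong i j d) (quotient-cong i j e)
  quotient-cong i j (+-cong d e)      = +-cong (quotient-cong i j d) (quotient-cong i j e)
  quotient-cong i j (*-cong d e)      =
    +-cong (*-cong (quotient-cong i j d) e) (*-cong (substX-cong _ d) (quotient-cong i j e))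
  quotient-cong i j (-‿cong e)        = -‿cong (quotient-cong i j e)
  quotient-cong i j (+-assoc f g h)   = +-assoc _ _ _
  quotient-cong i j (+-comm f g)      = +-comm _ _
  quotient-cong i j (+-identityˡ f)   = +-identityˡ _
  quotient-cong i j (-‿inverseˡ f)    = -‿inverseˡ _
  quotient-cong i j (*-assoc f g h)   =
    solve 7 (λ g h p q r a b → (p :* g :+ a :* q) :* h :+ (a :* b) :* r
                             := p :* (g :* h) :+ a :* (q :* h :+ b :* r))
      ≈-refl g h (quotient i j f) (quotient i j g) (quotient i j h) (restrict i j f) (restrict i j g)
  quotient-cong i j (*-comm f g)      = begin
    p * g + a * q                 ≈⟨ +-cong (*-cong ≈-refl (division i j g)) ≈-refl ⟩
    p * (b + d * q) + a * q       ≈⟨ solve 5 (λ a b d p q → p :* (b :+ d :* q) :+ a :* q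
                                       := q :* (a :+ d :* p) :+ b :* p) ≈-refl a b d p q ⟩
    q * (a + d * p) + b * p       ≈⟨ +-cong (*-cong ≈-refl (≈-sym (division i j f))) ≈-refl ⟩
    q * f + b * p                 ∎
    where
    a = restrict i j f
    b = restrict i j g
    p = quotient i j f
    q = quotient i j g
    d = x i - x j
  quotient-cong i j (*-identityˡ f)   =
    ≈-trans (+-cong (zeroˡ f) (*-identityˡ _)) (+-identityˡ _)
  quotient-cong i j (distribˡ f g h)  =
    solve 6 (λ g h p q r a → p :* (g :+ h) :+ a :* (q :+ r)
                           := (p :* g :+ a :* q) :+ (p :* h :+ a :* r))
      ≈-refl g h (quotient i j f) (quotient i j g) (quotient i j h) (restrict i j f)
  quotient-cong i j β-inverse         =
    ≈-trans (+-cong (zeroˡ _) (zeroʳ _)) (+-identityˡ 0#)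

  private
    restrict-i : ∀ (i j : Fin n) → restrict i j (x i) ≡ x j
    restrict-i i j rewrite dec-true (i Fin.≟ i) ≡.refl = ≡.refl

    restrict-j : ∀ (i j : Fin n) → restrict i j (x j) ≡ x j
    restrict-j i j with j Fin.≟ i
    ... | yes _ = ≡.refl
    ... | no _  = ≡.refl

    restrict-transpose : ∀ (i j : Fin n) f → restrict i j (transpose i j · f) ≡ restrict i j f
    restrict-transpose i j 0#      = ≡.refl
    restrict-transpose i j 1#      = ≡.refl
    restrict-transpose i j β       = ≡.refl
    restrict-transpose i j β⁻¹     = ≡.refl
    restrict-transpose i j (x k) with k Fin.≟ i
    ... | yes _ = restrict-j i j
    ... | no k≢i with k Fin.≟ j
    ...   | yes ≡.refl = restrict-i i j
    ...   | no _ rewrite dec-false (k Fin.≟ i) k≢i = ≡.refl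
    restrict-transpose i j (y k)   = ≡.refl
    restrict-transpose i j (f + g) = ≡.cong₂ _+_ (restrict-transpose i j f) (restrict-transpose i j g)
    restrict-transpose i j (f * g) = ≡.cong₂ _*_ (restrict-transpose i j f) (restrict-transpose i j g)
    restrict-transpose i j (- f)   = ≡.cong -_ (restrict-transpose i j f)

  -- When f is divisible by xᵢ − xⱼ, quotient i j f is the unique exact quotient;
  -- in particular xᵢ − xⱼ is not a zero divisor.
  quotient-exact : ∀ {i j : Fin n} → i ≢ j → ∀ {f g} → (x i - x j) * g ≈ f → quotient i j f ≈ g
  quotient-exact {i} {j} i≢j {f} {g} e = ≈-trans (≈-sym (quotient-cong i j e)) lemma
    where
    lemma : quotient i j ((x i - x j) * g) ≈ g
    lemma rewrite dec-true (i Fin.≟ i) ≡.refl | dec-false (j Fin.≟ i) (i≢j ∘ ≡.sym) = begin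
      (1# + - 0#) * g + (x j + - x j) * quotient i j g
        ≈⟨ +-cong (*-cong (≈-trans (+-cong ≈-refl -0#≈0#) (+-identityʳ 1#)) ≈-refl)
                  (≈-trans (*-cong (-‿inverseʳ (x j)) ≈-refl) (zeroˡ _)) ⟩
      1# * g + 0#  ≈⟨ +-identityʳ _ ⟩
      1# * g       ≈⟨ *-identityˡ g ⟩
      g            ∎

  π-exact : ∀ (i j : Fin n) f →
            (x i - x j) * π i j f ≈ (1# + β * x j) * f - (1# + β * x i) * (transpose i j · f)
  π-exact i j f = ≈-sym (begin
    h                                          ≈⟨ division i j h ⟩
    restrict i j h + (x i - x j) * π i j f     ≈⟨ +-cong vanish ≈-refl ⟩
    0# + (x i - x j) * π i j f                 ≈⟨ +-identityˡ _ ⟩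
    (x i - x j) * π i j f                      ∎)
    where
    h = (1# + β * x j) * f - (1# + β * x i) * (transpose i j · f)
    vanish : restrict i j h ≈ 0#
    vanish rewrite restrict-j i j | restrict-i i j | restrict-transpose i j f = -‿inverseʳ _

cells : ∀ n → List (Fin n × Fin n)
cells n = cartesianProduct (allFin n) (allFin n)

isInversion? : (w : Permutation′ n) →
               Decidable (λ ((a , b) : Fin n × Fin n) → a Fin.< b × w ⟨$⟩ʳ b Fin.< w ⟨$⟩ʳ a)
isInversion? w (a , b) = (a Fin.<? b) ×-dec (w ⟨$⟩ʳ b Fin.<? w ⟨$⟩ʳ a)

ℓ : Permutation′ n → ℕ
ℓ {n} w = length (filter (isInversion? w) (cells n))

-- The product over 1-based indices i + j ≤ n.
staircase : ∀ n → Poly n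
staircase n = ∏ (map (λ (i , j) → x i ⊕ y j)
  (filter (λ (i , j) → suc (toℕ i) ℕ.+ suc (toℕ j) ℕ.≤? n) (cells n)))

-- IsGrothendieck w f: f is the value 𝔊_w obtained from 𝔊_{w₀} along some chain of
-- descents.  In the library _∘ₚ_ composes left to right, so transpose i j ∘ₚ w
-- is w sᵢ.
data IsGrothendieck {n : ℕ} : Permutation′ n → Poly n → Set where
  longest : ∀ {w f} → w Perm.≈ reverse → f ≈ staircase n → IsGrothendieck w f
  descend : ∀ {w v f g} {i j : Fin n} →
            toℕ j ≡ suc (toℕ i) → w ⟨$⟩ʳ j Fin.< w ⟨$⟩ʳ i →
            IsGrothendieck w f →
            v Perm.≈ (transpose i j ∘ₚ w) → g ≈ π i j f → IsGrothendieck v g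

-- Every w is reached from w₀: moving up along ascents increases w
-- lexicographically until no ascent is left.
private
  _⊏_ : ∀ {m n} → (Fin m → Fin n) → (Fin m → Fin n) → Set
  u ⊏ w = ∃ λ p → (∀ k → k Fin.< p → u k ≡ w k) × w p Fin.< u p

  ⊏-acc : ∀ {m n} (w : Fin m → Fin n) → Acc _⊏_ w
  ⊏-acc {zero}      w = acc λ { (() , _) }
  ⊏-acc {suc m} {n} w = acc (go ≡.refl (Fin.>-wellFounded (w zero)) (⊏-acc (w ∘ suc)))
    where
    go : ∀ {w : Fin (suc m) → Fin n} {a} → w zero ≡ a → Acc Fin._>_ a →
         Acc _⊏_ (w ∘ suc) → ∀ {u} → u ⊏ w → Acc _⊏_ u
    go ≡.refl (acc rs) _ {u} (zero , _ , lt) =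
      acc (go ≡.refl (rs lt) (⊏-acc (u ∘ suc)))
    go w₀≡a a (acc rt) (suc p , eq , lt) =
      acc (go (≡.trans (eq zero (ℕ.s≤s ℕ.z≤n)) w₀≡a) a
              (rt (p , (λ k k<p → eq (suc k) (ℕ.s≤s k<p)) , lt)))

  Decreasing : (Fin n → Fin n) → Set
  Decreasing w = ∀ i j → toℕ j ≡ suc (toℕ i) → w j Fin.< w i

  decreasing-bound : (w : Fin n → Fin n) → Decreasing w →
                     ∀ m k → toℕ k ≡ m → toℕ (w k) ℕ.+ suc m ℕ.≤ n
  decreasing-bound w dec zero k eq rewrite ℕ.+-comm (toℕ (w k)) 1 = Fin.toℕ<n (w k)
  decreasing-bound {n} w dec (suc m) k eq = begin
    toℕ (w k) ℕ.+ suc (suc m)   ≡⟨ ℕ.+-suc _ _ ⟩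
    suc (toℕ (w k)) ℕ.+ suc m   ≤⟨ ℕ.+-monoˡ-≤ (suc m) (dec i k (≡.trans eq (≡.cong suc (≡.sym i≡m)))) ⟩
    toℕ (w i) ℕ.+ suc m         ≤⟨ decreasing-bound w dec m i i≡m ⟩
    n                           ∎
    where
    open ℕ.≤-Reasoning
    m<n : m ℕ.< n
    m<n = ℕ.≤-trans (ℕ.n≤1+n _) (≡.subst (ℕ._< n) eq (Fin.toℕ<n k))
    i = Fin.fromℕ< m<n
    i≡m = Fin.toℕ-fromℕ< m<n

  ≤-opposite : (w : Fin n → Fin n) → Decreasing w → ∀ k → toℕ (w k) ℕ.≤ toℕ (opposite k)
  ≤-opposite w dec k rewrite Fin.opposite-prop k =
    ℕ.m+n≤o⇒m≤o∸n _ (decreasing-bound w dec (toℕ k) k ≡.refl)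

  opposite-mono : ∀ {a b : Fin n} → a Fin.< b → opposite b Fin.< opposite a
  opposite-mono {n} {a} {b} a<b rewrite Fin.opposite-prop a | Fin.opposite-prop b =
    ℕ.∸-monoʳ-< (ℕ.s≤s a<b) (Fin.toℕ<n b)

  opposite-adj : ∀ {i j : Fin n} → toℕ j ≡ suc (toℕ i) → toℕ (opposite i) ≡ suc (toℕ (opposite j))
  opposite-adj {n} {i} {j} eq rewrite Fin.opposite-prop i | Fin.opposite-prop j | eq =
    ℕ.+-∸-assoc 1 (≡.subst (ℕ._< n) eq (Fin.toℕ<n j))

  decreasing⇒reverse : (w : Fin n → Fin n) → Decreasing w → ∀ k → w k ≡ opposite k
  decreasing⇒reverse w dec k = Fin.toℕ-injective
    (ℕ.≤-antisym (≤-opposite w dec k) (ℕ.≮⇒≥ λ lt → ℕ.<⇒≱ (opposite-mono lt) (bound k)))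
    where
    v = λ k → opposite (w (opposite k))
    bound : ∀ k → toℕ (opposite (w k)) ℕ.≤ toℕ (opposite (opposite k))
    bound k = ≡.subst (λ z → toℕ (opposite (w z)) ℕ.≤ toℕ (opposite (opposite k)))
      (Fin.opposite-involutive k)
      (≤-opposite v (λ i j eq → opposite-mono (dec (opposite j) (opposite i) (opposite-adj eq)))
        (opposite k))

  transposeˡ : ∀ (i j : Fin n) → transpose i j ⟨$⟩ʳ i ≡ j
  transposeˡ i j rewrite dec-true (i Fin.≟ i) ≡.refl = ≡.refl

  transposeʳ : ∀ {i j : Fin n} → i ≢ j → transpose i j ⟨$⟩ʳ j ≡ i
  transposeʳ {i = i} {j} i≢j
    rewrite dec-false (j Fin.≟ i) (i≢j ∘ ≡.sym) | dec-true (j Fin.≟ j) ≡.refl = ≡.refl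

  transpose-fixes : ∀ {i j k : Fin n} → k ≢ i → k ≢ j → transpose i j ⟨$⟩ʳ k ≡ k
  transpose-fixes {i = i} {j} {k} k≢i k≢j
    rewrite dec-false (k Fin.≟ i) k≢i | dec-false (k Fin.≟ j) k≢j = ≡.refl

  transpose-twice : ∀ {i j : Fin n} → i ≢ j → ∀ k → k ≡ transpose i j ⟨$⟩ʳ (transpose i j ⟨$⟩ʳ k)
  transpose-twice {i = i} {j} i≢j k with k Fin.≟ i
  ... | yes ≡.refl = ≡.sym (transposeʳ i≢j)
  ... | no k≢i with k Fin.≟ j
  ...   | yes ≡.refl = ≡.sym (transposeˡ i k)
  ...   | no k≢j = ≡.sym (transpose-fixes k≢i k≢j)

grothendieck-exists : (w : Permutation′ n) → ∃ (IsGrothendieck w)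
grothendieck-exists {n} w = go w (⊏-acc (w ⟨$⟩ʳ_))
  where
  go : ∀ w → Acc _⊏_ (w ⟨$⟩ʳ_) → ∃ (IsGrothendieck w)
  go w (acc rs)
    with Fin.any? (λ i → Fin.any? (λ j →
           (toℕ j ℕ.≟ suc (toℕ i)) ×-dec (w ⟨$⟩ʳ i Fin.<? w ⟨$⟩ʳ j)))
  ... | yes (i , j , eq , lt) = _ , descend eq up (proj₂ (go v (rs larger))) back ≈-refl
    where
    i<j : i Fin.< j
    i<j = ≡.subst (toℕ i ℕ.<_) (≡.sym eq) ℕ.≤-refl
    i≢j = Fin.<⇒≢ i<j
    v = transpose i j ∘ₚ w
    vi : v ⟨$⟩ʳ i ≡ w ⟨$⟩ʳ j
    vi = ≡.cong (w ⟨$⟩ʳ_) (transposeˡ i j)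
    vj : v ⟨$⟩ʳ j ≡ w ⟨$⟩ʳ i
    vj = ≡.cong (w ⟨$⟩ʳ_) (transposeʳ i≢j)
    up : v ⟨$⟩ʳ j Fin.< v ⟨$⟩ʳ i
    up = ≡.subst₂ Fin._<_ (≡.sym vj) (≡.sym vi) lt
    larger : (v ⟨$⟩ʳ_) ⊏ (w ⟨$⟩ʳ_)
    larger = i
      , (λ k k<i → ≡.cong (w ⟨$⟩ʳ_) (transpose-fixes (Fin.<⇒≢ k<i) (Fin.<⇒≢ (ℕ.<-trans k<i i<j))))
      , ≡.subst (w ⟨$⟩ʳ i Fin.<_) (≡.sym vi) lt
    back : w Perm.≈ (transpose i j ∘ₚ v)
    back k = ≡.cong (w ⟨$⟩ʳ_) (transpose-twice i≢j k)
  ... | no none = staircase n , longest (decreasing⇒reverse (w ⟨$⟩ʳ_) dec) ≈-refl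
    where
    dec : Decreasing (w ⟨$⟩ʳ_)
    dec i j eq = ℕ.≤∧≢⇒< (ℕ.≮⇒≥ λ lt → none (i , j , eq , lt)) λ e →
      Fin.<⇒≢ (≡.subst (toℕ i ℕ.<_) (≡.sym eq) ℕ.≤-refl)
        (≡.sym (Injection.injective (↔⇒↣ w) (Fin.toℕ-injective e)))

data Tile : Set where
  downElbow upElbow crossing blank horizontal vertical : Tile

tiles : List Tile
tiles = downElbow ∷ upElbow ∷ crossing ∷ blank ∷ horizontal ∷ vertical ∷ []

_≟ᵗ_ : (s t : Tile) → Dec (s ≡ t)
s ≟ᵗ t = map′ injective (≡.cong code) (code s ℕ.≟ code t)
  where
  code : Tile → ℕ
  code downElbow  = 0
  code upElbow    = 1
  code crossing   = 2
  code blank      = 3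
  code horizontal = 4
  code vertical   = 5
  decode : ℕ → Tile
  decode 0 = downElbow
  decode 1 = upElbow
  decode 2 = crossing
  decode 3 = blank
  decode 4 = horizontal
  decode _ = vertical
  retract : ∀ t → decode (code t) ≡ t
  retract downElbow  = ≡.refl
  retract upElbow    = ≡.refl
  retract crossing   = ≡.refl
  retract blank      = ≡.refl
  retract horizontal = ≡.refl
  retract vertical   = ≡.refl
  injective : code s ≡ code t → s ≡ t
  injective e = ≡.trans (≡.sym (retract s)) (≡.trans (≡.cong decode e) (retract t))

-- Whether a pipe of the tile meets the given edge.
left right top bottom : Tile → Bool
left downElbow  = false
left upElbow    = true
left crossing   = true
left blank      = false
left horizontal = true
left vertical   = false

right downElbow  = true
right upElbow    = false
right crossing   = true
right blank      = false
right horizontal = true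
right vertical   = false

top downElbow  = false
top upElbow    = true
top crossing   = true
top blank      = false
top horizontal = false
top vertical   = true

bottom downElbow  = true
bottom upElbow    = false
bottom crossing   = true
bottom blank      = false
bottom horizontal = false
bottom vertical   = true

-- The vector of rows, from top to bottom.
Tiling : ℕ → Set
Tiling n = Vec (Vec Tile n) n

_at_,_ : Tiling n → Fin n → Fin n → Tile
T at i , j = lookup (lookup T i) j

record IsBPD {n : ℕ} (T : Tiling n) : Set where
  constructor isBPD
  field
    matchHorizontal : ∀ i j j′ → toℕ j′ ≡ suc (toℕ j) → right (T at i , j) ≡ left (T at i , j′)
    matchVertical   : ∀ i i′ j → toℕ i′ ≡ suc (toℕ i) → bottom (T at i , j) ≡ top (T at i′ , j)
    bottomBoundary  : ∀ i j → suc (toℕ i) ≡ n → bottom (T at i , j) ≡ true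
    rightBoundary   : ∀ i j → suc (toℕ j) ≡ n → right (T at i , j) ≡ true
    leftBoundary    : ∀ i j → toℕ j ≡ 0 → left (T at i , j) ≡ false
    topBoundary     : ∀ i j → toℕ i ≡ 0 → top (T at i , j) ≡ false

isBPD? : Decidable (IsBPD {n})
isBPD? {n} T = map′
  (λ (a , b , c , d , e , f) → isBPD a b c d e f)
  (λ (isBPD a b c d e f) → a , b , c , d , e , f)
  (  Fin.all? (λ i → Fin.all? (λ j → Fin.all? (λ j′ →
       (toℕ j′ ℕ.≟ suc (toℕ j)) →-dec (right (T at i , j) Bool.≟ left (T at i , j′)))))
  ×-dec Fin.all? (λ i → Fin.all? (λ i′ → Fin.all? (λ j →
       (toℕ i′ ℕ.≟ suc (toℕ i)) →-dec (bottom (T at i , j) Bool.≟ top (T at i′ , j)))))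
  ×-dec Fin.all? (λ i → Fin.all? (λ j →
       (suc (toℕ i) ℕ.≟ n) →-dec (bottom (T at i , j) Bool.≟ true)))
  ×-dec Fin.all? (λ i → Fin.all? (λ j →
       (suc (toℕ j) ℕ.≟ n) →-dec (right (T at i , j) Bool.≟ true)))
  ×-dec Fin.all? (λ i → Fin.all? (λ j →
       (toℕ j ℕ.≟ 0) →-dec (left (T at i , j) Bool.≟ false)))
  ×-dec Fin.all? (λ i → Fin.all? (λ j →
       (toℕ i ℕ.≟ 0) →-dec (top (T at i , j) Bool.≟ false))))

-- The label of the pipe on an edge, nothing if no pipe meets the edge.
-- Labels are counted from 0.
Label : Set
Label = Maybe ℕ

-- From the labels on the left and bottom edges of a tile to those on its right
-- and top edges.
propagate : Tile → Label → Label → Label × Label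
propagate downElbow  l b = b , nothing
propagate upElbow    l b = nothing , l
propagate crossing   l b = zipWith ℕ._⊓_ l b , zipWith ℕ._⊔_ l b
propagate blank      l b = nothing , nothing
propagate horizontal l b = l , nothing
propagate vertical   l b = nothing , b

-- From the labels on the left edge and the bottom edges of a row of tiles to
-- those on its right edge and its top edges.
propagateRow : ∀ {m} → Vec Tile m → Label → Vec Label m → Label × Vec Label m
propagateRow []       l []       = l , []
propagateRow (t ∷ ts) l (b ∷ bs) =
  let l′ , u  = propagate t l b
      r  , us = propagateRow ts l′ bs
  in r , u ∷ us

-- From the labels on the bottom edges of a stack of rows to those on its right
-- edges (from top to bottom) and its top edges.
propagateRows : ∀ {m} → Vec (Vec Tile n) m → Vec Label n → Vec Label m × Vec Label n
propagateRows []       bs = [] , bs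
propagateRows (R ∷ Rs) bs =
  let rs , ms = propagateRows Rs bs
      r  , us = propagateRow R nothing ms
  in r ∷ rs , us

∂ : Tiling n → Vec Label n
∂ T = proj₁ (propagateRows T (tabulate (λ j → just (toℕ j))))

HasDemazureProduct : Permutation′ n → Tiling n → Set
HasDemazureProduct w T = ∀ i → lookup (∂ T) i ≡ just (toℕ (w ⟨$⟩ʳ i))

hasDemazureProduct? : (w : Permutation′ n) → Decidable (HasDemazureProduct w)
hasDemazureProduct? w T = Fin.all? λ i → Maybe.≡-dec ℕ._≟_ _ _

vectors : {A : Set} → List A → ∀ m → List (Vec A m)
vectors as zero    = [] ∷ []
vectors as (suc m) = cartesianProductWith _∷_ as (vectors as m)

tilings : ∀ n → List (Tiling n)
tilings n = vectors (vectors tiles n) n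

Pipes : Permutation′ n → List (Tiling n)
Pipes {n} w = filter (λ T → isBPD? T ×-dec hasDemazureProduct? w T) (tilings n)

D U : Tiling n → List (Fin n × Fin n)
D {n} T = filter (λ (i , j) → (T at i , j) ≟ᵗ blank) (cells n)
U {n} T = filter (λ (i , j) → (T at i , j) ≟ᵗ upElbow) (cells n)

wt : Tiling n → Poly n
wt T = ∏ (map (λ (i , j) → β * (x i ⊕ y j)) (D T))
     * ∏ (map (λ (i , j) → 1# + β * (x i ⊕ y j)) (U T))

-- With X = 1 + β xᵢ and Y = 1 + β yⱼ, the weight of a bumpless pipe dream is a
-- product of vertex weights depending only on X Y, so the sum over all pipe
-- dreams is the partition function of a colored lattice model: labels enter at
-- the bottom and are propagated through one row after the other.  Let F_w be the
-- partition function with w on the right boundary.  The Yang–Baxter equation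
-- exchanges the parameters of rows i and i + 1; attaching its vertex to the left
-- boundary and moving it across to the right boundary gives, for wᵢ > wᵢ₊₁,
--   (1 + β xᵢ) sᵢ F_w = (1 + β xᵢ₊₁) F_w + β (xᵢ₊₁ − xᵢ) F_{w sᵢ},
-- that is πᵢ F_w = β F_{w sᵢ}.  For w₀ each row forces its labels, which leaves
-- the staircase product.

module Submission where

open import Defs
open import Algebra.Bundles using (CommutativeRing; CommutativeMonoid)
import Algebra.Properties.CommutativeMonoid.Sum as Sum
open import Data.Bool using (Bool; true; false; if_then_else_; _∧_)
import Data.Bool.Properties as Bool
open import Data.Fin using (Fin; zero; suc; toℕ; opposite)
import Data.Fin as Fin
import Data.Fin.Properties as Fin
open import Data.Fin.Permutation as Perm using (Permutation′; _⟨$⟩ʳ_; _∘ₚ_; transpose; reverse)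
open import Data.List using (List; []; _∷_; _++_; foldr; map; filter; length; allFin; cartesianProductWith)
import Data.List as List
import Data.List.Properties as List
open import Data.Maybe using (Maybe; just; nothing; is-just)
import Data.Maybe.Properties as Maybe
open import Data.Nat using (ℕ; zero; suc; _≤_; _<_; _⊓_; _⊔_; z≤n; s≤s; _<ᵇ_)
import Data.Nat as ℕ
import Data.Nat.Properties as ℕ
open import Data.Product using (_×_; _,_; proj₁; proj₂)
open import Data.Sum using (inj₁; inj₂)
open import Data.Unit using (⊤; tt)
open import Data.Vec using (Vec; []; _∷_; lookup; tabulate)
import Data.Vec.Properties as Vec
open import Function using (_∘_; id; mk⇔)
open import Relation.Binary.PropositionalEquality as ≡ using (_≡_; _≢_)
open import Relation.Nullary using (¬_; Dec; yes; no; does)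
open import Relation.Nullary.Decidable using (_×-dec_; does-⇔; dec-true; dec-false)
open import Relation.Unary using (Pred; Decidable)
open import Level using (0ℓ)

-- The Demazure rule makes a crossing a sorting device, and the auxiliary vertex is one too: its
-- second term, weighted by the difference of the two row parameters, puts the larger label into the
-- upper row. Its behaviour at the two boundaries gives the recursion. On two empty edges it has a
-- single term, weighted by the parameter of the lower row, so attaching it on the left costs one
-- factor. On the right a decreasing pair of required labels is reached by sorting from either
-- order, and the second order brings in `w sᵢ`.
--
-- Labels are unbounded numbers, so there is no finite transfer matrix. A row or a grid is instead a
-- linear functional summing an arbitrary observable of its outgoing labels: stacking is
-- composition, interchange of sums is linearity, and Yang-Baxter is tested against every
-- observable. To bring the sum over tilings into this form, matching of edges is replaced by
-- agreement of each tile with the labels that have reached it, a constraint that factors tile by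
-- tile along the propagation.

fits? : (left? bottom? : Bool) → Decidable (λ t → left t ≡ left? × bottom t ≡ bottom?)
fits? left? bottom? t = (left t Bool.≟ left?) ×-dec (bottom t Bool.≟ bottom?)

-- Absent labels count as the largest.
descending : Label → Label → Label × Label
descending (just a) (just b) = just (a ⊔ b) , just (a ⊓ b)
descending nothing  l        = nothing , l
descending (just a) nothing  = nothing , just a

-- Minima and maxima of labels

⊔-⊓-⊓ : ∀ a b → (a ⊔ b) ⊓ (a ⊓ b) ≡ a ⊓ b
⊔-⊓-⊓ a b = ℕ.m≥n⇒m⊓n≡n (ℕ.≤-trans (ℕ.m⊓n≤m a b) (ℕ.m≤m⊔n a b))

⊔-⊔-⊓ : ∀ a b → (a ⊔ b) ⊔ (a ⊓ b) ≡ a ⊔ b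
⊔-⊔-⊓ a b = ℕ.m≥n⇒m⊔n≡m (ℕ.≤-trans (ℕ.m⊓n≤m a b) (ℕ.m≤m⊔n a b))

⊓-⊔-⊓ : ∀ a b c → (a ⊓ (b ⊔ c)) ⊓ (b ⊓ c) ≡ (a ⊓ b) ⊓ c
⊓-⊔-⊓ a b c = ≡.trans (ℕ.⊓-assoc a (b ⊔ c) (b ⊓ c))
  (≡.trans (≡.cong (a ⊓_) (⊔-⊓-⊓ b c)) (≡.sym (ℕ.⊓-assoc a b c)))

⊔-⊓-join : ∀ a b c → (a ⊔ b) ⊔ ((a ⊓ b) ⊔ c) ≡ a ⊔ (b ⊔ c)
⊔-⊓-join a b c = ≡.trans (≡.sym (ℕ.⊔-assoc (a ⊔ b) (a ⊓ b) c))
  (≡.trans (≡.cong (_⊔ c) (⊔-⊔-⊓ a b)) (ℕ.⊔-assoc a b c))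

-- Both sides are the median of the three labels. Together with `⊔-⊓-join` and `⊓-⊔-⊓` it says that
-- sorting the two horizontal labels before a column of two crossings, or after it, yields the same
-- maximum, median and minimum.
⊔-⊓-median : ∀ a b c → (a ⊔ b) ⊓ ((a ⊓ b) ⊔ c) ≡ (a ⊓ (b ⊔ c)) ⊔ (b ⊓ c)
⊔-⊓-median a b c = begin
  (a ⊔ b) ⊓ ((a ⊓ b) ⊔ c)              ≡⟨ ℕ.⊓-distribˡ-⊔ (a ⊔ b) (a ⊓ b) c ⟩
  ((a ⊔ b) ⊓ (a ⊓ b)) ⊔ ((a ⊔ b) ⊓ c)  ≡⟨ ≡.cong₂ _⊔_ (⊔-⊓-⊓ a b) (ℕ.⊓-distribʳ-⊔ c a b) ⟩
  (a ⊓ b) ⊔ ((a ⊓ c) ⊔ (b ⊓ c))        ≡⟨ ≡.sym (ℕ.⊔-assoc (a ⊓ b) (a ⊓ c) (b ⊓ c)) ⟩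
  ((a ⊓ b) ⊔ (a ⊓ c)) ⊔ (b ⊓ c)        ≡⟨ ≡.cong (_⊔ (b ⊓ c)) (≡.sym (ℕ.⊓-distribˡ-⊔ a b c)) ⟩
  (a ⊓ (b ⊔ c)) ⊔ (b ⊓ c)              ∎
  where open ≡.≡-Reasoning

-- Adjacent positions and their transpositions

-- Inductive, so that recursion can descend through the rows to the exchanged pair, where `here`
-- lets `transpose` compute.
data Adjacent : ∀ {m} → Fin m → Fin m → Set where
  here  : ∀ {m} → Adjacent {suc (suc m)} zero (suc zero)
  there : ∀ {m} {i j : Fin m} → Adjacent i j → Adjacent (suc i) (suc j)

adjacent : ∀ {m} (i j : Fin m) → toℕ j ≡ suc (toℕ i) → Adjacent i j
adjacent zero    (suc zero) e = here
adjacent (suc i) (suc j)    e = there (adjacent i j (ℕ.suc-injective e))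

transpose-suc : ∀ {m} (i j k : Fin m) → transpose (suc i) (suc j) ⟨$⟩ʳ suc k ≡ suc (transpose i j ⟨$⟩ʳ k)
transpose-suc i j k with does (k Fin.≟ i)
... | true  = ≡.refl
... | false with does (k Fin.≟ j)
...   | true  = ≡.refl
...   | false = ≡.refl

-- The offset `c` makes induction along a row possible; by `labels-tabulate` the case `c = 0` is the
-- labelling of the bottom boundary.
labels : ∀ m → ℕ → Vec Label m
labels zero    c = []
labels (suc m) c = just c ∷ labels m (suc c)

transpose-first : ∀ {m} {i j : Fin m} → Adjacent i j → transpose i j ⟨$⟩ʳ i ≡ j
transpose-first here = ≡.refl
transpose-first {i = suc i} {suc j} (there a) = ≡.trans (transpose-suc i j i) (≡.cong suc (transpose-first a))

transpose-second : ∀ {m} {i j : Fin m} → Adjacent i j → transpose i j ⟨$⟩ʳ j ≡ i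
transpose-second here = ≡.refl
transpose-second {i = suc i} {suc j} (there a) = ≡.trans (transpose-suc i j j) (≡.cong suc (transpose-second a))

transpose-twice : ∀ {m} {i j : Fin m} → Adjacent i j → ∀ k → transpose i j ⟨$⟩ʳ (transpose i j ⟨$⟩ʳ k) ≡ k
transpose-twice here zero          = ≡.refl
transpose-twice here (suc zero)    = ≡.refl
transpose-twice here (suc (suc k)) = ≡.refl
transpose-twice (there a) zero     = ≡.refl
transpose-twice {i = suc i} {suc j} (there a) (suc k)
  rewrite transpose-suc i j k | transpose-suc i j (transpose i j ⟨$⟩ʳ k) = ≡.cong suc (transpose-twice a k)

-- Folds over lists and inversion counts

-- Stated for any commutative monoid because `∑`, `∏` and the counting sums in `ℕ` are all instances
-- of this `foldr`.
module Fold {c ℓ} (M : CommutativeMonoid c ℓ) where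
  open CommutativeMonoid M renaming (_≈_ to _≋_)
  open import Algebra.Properties.CommutativeSemigroup commutativeSemigroup using (interchange)
  open Sum M using (sum; sum-cong-≋)

  fold : List Carrier → Carrier
  fold = foldr _∙_ ε

  fold-cong : ∀ {A : Set} {f g : A → Carrier} → (∀ a → f a ≋ g a) → ∀ as → fold (map f as) ≋ fold (map g as)
  fold-cong e []       = refl
  fold-cong e (a ∷ as) = ∙-cong (e a) (fold-cong e as)

  fold-++ : ∀ as bs → fold (as ++ bs) ≋ fold as ∙ fold bs
  fold-++ []       bs = sym (identityˡ _)
  fold-++ (a ∷ as) bs = trans (∙-cong refl (fold-++ as bs)) (sym (assoc _ _ _))

  fold-distrib : ∀ {A : Set} (f g : A → Carrier) as → fold (map (λ a → f a ∙ g a) as) ≋ fold (map f as) ∙ fold (map g as)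
  fold-distrib f g []       = sym (identityˡ ε)
  fold-distrib f g (a ∷ as) = trans (∙-cong refl (fold-distrib f g as)) (interchange (f a) (g a) _ _)

  fold-swap : ∀ {A B : Set} (f : A → B → Carrier) as bs →
    fold (map (λ a → fold (map (f a) bs)) as) ≋ fold (map (λ b → fold (map (λ a → f a b) as)) bs)
  fold-swap f []       []       = refl
  fold-swap f []       (b ∷ bs) = trans (fold-swap f [] bs) (sym (identityˡ _))
  fold-swap f (a ∷ as) bs       = trans (∙-cong refl (fold-swap f as bs)) (sym (fold-distrib (f a) _ bs))

  fold-filter : ∀ {A : Set} {P : Pred A 0ℓ} (P? : Decidable P) (f : A → Carrier) as →
                fold (map f (filter P? as)) ≋ fold (map (λ a → if does (P? a) then f a else ε) as)
  fold-filter P? f [] = refl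
  fold-filter P? f (a ∷ as) with does (P? a)
  ... | true  = ∙-cong refl (fold-filter P? f as)
  ... | false = trans (fold-filter P? f as) (sym (identityˡ _))

  fold-cartesianProductWith : ∀ {A B C : Set} (f : C → Carrier) (g : A → B → C) as bs →
    fold (map f (cartesianProductWith g as bs)) ≋ fold (map (λ a → fold (map (λ b → f (g a b)) bs)) as)
  fold-cartesianProductWith f g []       bs = refl
  fold-cartesianProductWith f g (a ∷ as) bs = trans
    (reflexive (≡.cong fold (≡.trans (List.map-++ f (map (g a) bs) _) (≡.cong (_++ _) (≡.sym (List.map-∘ bs))))))
    (trans (fold-++ (map (f ∘ g a) bs) _) (∙-cong refl (fold-cartesianProductWith f g as bs)))

  fold-tabulate : ∀ {A : Set} {n} (f : A → Carrier) (g : Fin n → A) → fold (map f (List.tabulate g)) ≋ sum (f ∘ g)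
  fold-tabulate {n = zero}  f g = refl
  fold-tabulate {n = suc n} f g = ∙-cong refl (fold-tabulate f (g ∘ suc))

  -- Iterated sums over `Fin`, unlike the list of cells, can be reindexed by a permutation; the
  -- inversion counts depend on this.
  fold-cells : ∀ {n} (f : Fin n × Fin n → Carrier) → fold (map f (cells n)) ≋ sum (λ i → sum (λ j → f (i , j)))
  fold-cells {n} f = trans (fold-cartesianProductWith f _,_ (allFin n) (allFin n))
    (trans (fold-tabulate {n = n} (λ i → fold (map (λ j → f (i , j)) (allFin n))) id)
      (sum-cong-≋ {n} λ i → fold-tabulate {n = n} (λ j → f (i , j)) id))

module _ where
  open Sum ℕ.+-0-commutativeMonoid
  open Fold ℕ.+-0-commutativeMonoid

  count : {A : Set} → Dec A → ℕ
  count d = if does d then 1 else 0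

  count-yes : ∀ {A : Set} (d : Dec A) → A → count d ≡ 1
  count-yes d a rewrite dec-true d a = ≡.refl

  count-no : ∀ {A : Set} (d : Dec A) → ¬ A → count d ≡ 0
  count-no d ¬a rewrite dec-false d ¬a = ≡.refl

  count-⇔ : ∀ {A B : Set} (d : Dec A) (e : Dec B) → (A → B) → (B → A) → count d ≡ count e
  count-⇔ d e f g = ≡.cong (λ b → if b then 1 else 0) (does-⇔ (mk⇔ f g) d e)

  length-filter : ∀ {A : Set} {P : Pred A 0ℓ} (P? : Decidable P) as → length (filter P? as) ≡ fold (map (count ∘ P?) as)
  length-filter P? [] = ≡.refl
  length-filter P? (a ∷ as) with does (P? a)
  ... | true  = ≡.cong suc (length-filter P? as)
  ... | false = length-filter P? as

  length-filter-cells : ∀ {n} {P : Pred (Fin n × Fin n) 0ℓ} (P? : Decidable P) →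
                        length (filter P? (cells n)) ≡ sum (λ i → sum (λ j → count (P? (i , j))))
  length-filter-cells P? = ≡.trans (length-filter P? (cells _)) (fold-cells (count ∘ P?))

  sum-single : ∀ {n} (f : Fin n → ℕ) i → (∀ j → j ≢ i → f j ≡ 0) → sum f ≡ f i
  sum-single {suc n} f zero z = ≡.trans
    (≡.cong (f zero ℕ.+_) (≡.trans (sum-cong-≗ (λ j → z (suc j) λ ())) (sum-replicate-zero n))) (ℕ.+-identityʳ _)
  sum-single f (suc i) z = ≡.trans (≡.cong (ℕ._+ sum (f ∘ suc)) (z zero λ ()))
    (sum-single (f ∘ suc) i λ j j≢i → z (suc j) (j≢i ∘ Fin.suc-injective))

  -- An adjacent transposition reverses the order of one pair of positions only; `up` and `down` are
  -- its two orders. `kept` excludes `(j , i)` explicitly because the surplus inversion in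
  -- `ℓ-descent` is counted there.
  data Comparison {n} (i j a b a′ b′ : Fin n) : Set where
    up   : a ≡ i → b ≡ j → ¬ a′ Fin.< b′ → a′ ≡ j → b′ ≡ i → Comparison i j a b a′ b′
    down : a ≡ j → b ≡ i → a′ Fin.< b′ → ¬ a Fin.< b → a′ ≡ i → b′ ≡ j → Comparison i j a b a′ b′
    kept : ¬ (a ≡ j × b ≡ i) → (a Fin.< b → a′ Fin.< b′) → (a′ Fin.< b′ → a Fin.< b) → Comparison i j a b a′ b′

  compare : ∀ {n} {i j : Fin n} → Adjacent i j → ∀ a b → Comparison i j a b (transpose i j ⟨$⟩ʳ a) (transpose i j ⟨$⟩ʳ b)
  compare here zero          zero          = kept (λ ()) (λ ()) (λ { (s≤s ()) })
  compare here zero          (suc zero)    = up ≡.refl ≡.refl (λ ()) ≡.refl ≡.refl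
  compare here zero          (suc (suc b)) = kept (λ ()) (λ _ → s≤s (s≤s z≤n)) (λ _ → s≤s z≤n)
  compare here (suc zero)    zero          = down ≡.refl ≡.refl (s≤s z≤n) (λ ()) ≡.refl ≡.refl
  compare here (suc zero)    (suc zero)    = kept (λ ()) (λ { (s≤s ()) }) (λ ())
  compare here (suc zero)    (suc (suc b)) = kept (λ ()) (λ _ → s≤s z≤n) (λ _ → s≤s (s≤s z≤n))
  compare here (suc (suc a)) zero          = kept (λ ()) (λ ()) (λ { (s≤s ()) })
  compare here (suc (suc a)) (suc zero)    = kept (λ ()) (λ { (s≤s ()) }) (λ ())
  compare here (suc (suc a)) (suc (suc b)) = kept (λ ()) (λ p → p) (λ p → p)
  compare (there _) zero zero = kept (λ ()) (λ ()) (λ ())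
  compare {i = suc i} {suc j} (there _) zero (suc b) rewrite transpose-suc i j b = kept (λ ()) (λ _ → s≤s z≤n) (λ _ → s≤s z≤n)
  compare {i = suc i} {suc j} (there _) (suc a) zero rewrite transpose-suc i j a = kept (λ ()) (λ ()) (λ ())
  compare {i = suc i} {suc j} (there p) (suc a) (suc b) rewrite transpose-suc i j a | transpose-suc i j b with compare p a b
  ... | up e₁ e₂ n e₃ e₄     = up (≡.cong suc e₁) (≡.cong suc e₂) (n ∘ ℕ.s≤s⁻¹) (≡.cong suc e₃) (≡.cong suc e₄)
  ... | down e₁ e₂ l n e₃ e₄ = down (≡.cong suc e₁) (≡.cong suc e₂) (s≤s l) (n ∘ ℕ.s≤s⁻¹) (≡.cong suc e₃) (≡.cong suc e₄)
  ... | kept n f g           = kept (λ (e₁ , e₂) → n (Fin.suc-injective e₁ , Fin.suc-injective e₂))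
                                 (s≤s ∘ f ∘ ℕ.s≤s⁻¹) (s≤s ∘ g ∘ ℕ.s≤s⁻¹)

  -- Both positions are reindexed by the transposition, which turns values of `w` into values of
  -- `v`. The counts then agree except at `(j , i)`: it is sent to the descent of `w` but is not an
  -- increasing pair itself. `δ` is the indicator of that pair.
  ℓ-descent : ∀ {n} {i j : Fin n} → Adjacent i j → (w v : Permutation′ n) →
              w ⟨$⟩ʳ j Fin.< w ⟨$⟩ʳ i → v Perm.≈ (transpose i j ∘ₚ w) → ℓ w ≡ suc (ℓ v)
  ℓ-descent {n} {i} {j} adj w v w< v≈ = begin
    ℓ w
      ≡⟨ length-filter-cells (isInversion? w) ⟩
    sum (λ a → sum (λ b → count (isInversion? w (a , b))))
      ≡⟨ sum-permute (λ a → sum (λ b → count (isInversion? w (a , b)))) s ⟩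
    sum (λ a → sum (λ b → count (isInversion? w (s ⟨$⟩ʳ a , b))))
      ≡⟨ sum-cong-≗ (λ a → sum-permute (λ b → count (isInversion? w (s ⟨$⟩ʳ a , b))) s) ⟩
    sum (λ a → sum (λ b → count (isInversion? w (s ⟨$⟩ʳ a , s ⟨$⟩ʳ b))))
      ≡⟨ sum-cong-≗ (λ a → sum-cong-≗ (λ b → pointwise a b (compare adj a b))) ⟩
    sum (λ a → sum (λ b → count (isInversion? v (a , b)) ℕ.+ δ a b))
      ≡⟨ sum-cong-≗ (λ a → ∑-distrib-+ (λ b → count (isInversion? v (a , b))) (δ a)) ⟩
    sum (λ a → sum (λ b → count (isInversion? v (a , b))) ℕ.+ sum (δ a))
      ≡⟨ ∑-distrib-+ (λ a → sum (λ b → count (isInversion? v (a , b)))) (λ a → sum (δ a)) ⟩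
    sum (λ a → sum (λ b → count (isInversion? v (a , b)))) ℕ.+ sum (λ a → sum (δ a))
      ≡⟨ ≡.cong₂ ℕ._+_ (≡.sym (length-filter-cells (isInversion? v))) sum-δ ⟩
    ℓ v ℕ.+ 1
      ≡⟨ ℕ.+-comm (ℓ v) 1 ⟩
    suc (ℓ v) ∎
    where
    open ≡.≡-Reasoning
    s = transpose i j
    i≢j : i ≢ j
    i≢j ≡.refl = ℕ.<-irrefl ≡.refl w<
    δ : Fin n → Fin n → ℕ
    δ a b = count ((a Fin.≟ j) ×-dec (b Fin.≟ i))
    δ? : ∀ a b → Dec (a ≡ j × b ≡ i)
    δ? a b = (a Fin.≟ j) ×-dec (b Fin.≟ i)
    sum-δ : sum (λ a → sum (δ a)) ≡ 1
    sum-δ = ≡.trans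
      (sum-single (λ a → sum (δ a)) j λ a a≢j → ≡.trans
        (sum-single (δ a) i λ b _ → count-no (δ? a b) (a≢j ∘ proj₁)) (count-no (δ? a i) (a≢j ∘ proj₁)))
      (≡.trans (sum-single (δ j) i λ b b≢i → count-no (δ? j b) (b≢i ∘ proj₂)) (count-yes (δ? j i) (≡.refl , ≡.refl)))
    pointwise : ∀ a b → Comparison i j a b (s ⟨$⟩ʳ a) (s ⟨$⟩ʳ b) →
                count (isInversion? w (s ⟨$⟩ʳ a , s ⟨$⟩ʳ b)) ≡ count (isInversion? v (a , b)) ℕ.+ δ a b
    pointwise a b (up e₁ e₂ s≮ e₃ e₄) = ≡.trans (count-no (isInversion? w (s ⟨$⟩ʳ a , s ⟨$⟩ʳ b)) (s≮ ∘ proj₁))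
      (≡.sym (≡.cong₂ ℕ._+_ (count-no (isInversion? v (a , b)) not-inversion)
        (count-no (δ? a b) λ (a≡j , _) → i≢j (≡.trans (≡.sym e₁) a≡j))))
      where
      not-inversion : ¬ (a Fin.< b × v ⟨$⟩ʳ b Fin.< v ⟨$⟩ʳ a)
      not-inversion (_ , v<) = ℕ.<-asym w< (≡.subst₂ Fin._<_
        (≡.trans (v≈ b) (≡.cong (w ⟨$⟩ʳ_) e₄)) (≡.trans (v≈ a) (≡.cong (w ⟨$⟩ʳ_) e₃)) v<)
    pointwise a b (down e₁ e₂ s< ≮ e₃ e₄) = ≡.trans
      (count-yes (isInversion? w (s ⟨$⟩ʳ a , s ⟨$⟩ʳ b))
        (s< , ≡.subst₂ (λ p q → w ⟨$⟩ʳ p Fin.< w ⟨$⟩ʳ q) (≡.sym e₄) (≡.sym e₃) w<))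
      (≡.sym (≡.cong₂ ℕ._+_ (count-no (isInversion? v (a , b)) (≮ ∘ proj₁)) (count-yes (δ? a b) (e₁ , e₂))))
    pointwise a b (kept n f g) = ≡.trans
      (count-⇔ (isInversion? w (s ⟨$⟩ʳ a , s ⟨$⟩ʳ b)) (isInversion? v (a , b))
        (λ (s< , w<) → g s< , ≡.subst₂ Fin._<_ (≡.sym (v≈ b)) (≡.sym (v≈ a)) w<)
        (λ (l , v<) → f l , ≡.subst₂ Fin._<_ (v≈ b) (v≈ a) v<))
      (≡.sym (≡.trans (≡.cong (count (isInversion? v (a , b)) ℕ.+_) (count-no (δ? a b) n)) (ℕ.+-identityʳ _)))

-- Label states for the longest permutation

-- Asking for a larger label, not merely a different one, makes this an invariant of the carried
-- label: it survives taking minima with further labels above `a`.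
data _Avoids_ : Label → ℕ → Set where
  absent : ∀ {a} → nothing Avoids a
  larger : ∀ {a d} → a < d → just d Avoids a

-- For `w₀` each row, from the bottom up, takes out the smallest label left. This is the state above
-- the lowest `r` rows; the remaining labels have not moved from their columns.
withoutFirst : ℕ → ∀ m → ℕ → Vec Label m
withoutFirst zero    m       c = labels m c
withoutFirst (suc r) zero    c = []
withoutFirst (suc r) (suc m) c = nothing ∷ withoutFirst r m (suc c)

-- Tilings with consistent labels

-- Edge matching in terms of labels. The condition on the remaining tiles sees the earlier ones only
-- through the label passed on, so a sum over rows can be carried out one tile at a time.
RowConsistent : ∀ {m} → Vec Tile m → Label → Vec Label m → Set
RowConsistent []       l []       = ⊤
RowConsistent (t ∷ ts) l (b ∷ bs) =
  (left t ≡ is-just l × bottom t ≡ is-just b) × RowConsistent ts (proj₁ (propagate t l b)) bs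

rowConsistent? : ∀ {m} (ts : Vec Tile m) l bs → Dec (RowConsistent ts l bs)
rowConsistent? []       l []       = yes tt
rowConsistent? (t ∷ ts) l (b ∷ bs) =
  fits? (is-just l) (is-just b) t ×-dec rowConsistent? ts (proj₁ (propagate t l b)) bs

GridConsistent : ∀ {m n} → Vec (Vec Tile n) m → Vec Label n → Set
GridConsistent []       bs = ⊤
GridConsistent (R ∷ Rs) bs = GridConsistent Rs bs × RowConsistent R nothing (proj₂ (propagateRows Rs bs))

gridConsistent? : ∀ {m n} (T : Vec (Vec Tile n) m) bs → Dec (GridConsistent T bs)
gridConsistent? []       bs = yes tt
gridConsistent? (R ∷ Rs) bs = gridConsistent? Rs bs ×-dec rowConsistent? R nothing (proj₂ (propagateRows Rs bs))

-- A tile passes labels on without checking them, so presence on an outgoing edge follows the shape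
-- of the tile only if presence on the incoming edges does.
propagate-right : ∀ t l b → left t ≡ is-just l → bottom t ≡ is-just b → is-just (proj₁ (propagate t l b)) ≡ right t
propagate-right downElbow  l        b        eₗ e = ≡.sym e
propagate-right upElbow    l        b        eₗ e = ≡.refl
propagate-right crossing   (just _) (just _) eₗ e = ≡.refl
propagate-right blank      l        b        eₗ e = ≡.refl
propagate-right horizontal l        b        eₗ e = ≡.sym eₗ
propagate-right vertical   l        b        eₗ e = ≡.refl

propagate-top : ∀ t l b → left t ≡ is-just l → bottom t ≡ is-just b → is-just (proj₂ (propagate t l b)) ≡ top t
propagate-top downElbow  l        b        eₗ e = ≡.refl
propagate-top upElbow    l        b        eₗ e = ≡.sym eₗ
propagate-top crossing   (just _) (just _) eₗ e = ≡.refl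
propagate-top blank      l        b        eₗ e = ≡.refl
propagate-top horizontal l        b        eₗ e = ≡.refl
propagate-top vertical   l        b        eₗ e = ≡.sym e

row-bottom : ∀ {m} (ts : Vec Tile m) l bs → RowConsistent ts l bs → ∀ j → bottom (lookup ts j) ≡ is-just (lookup bs j)
row-bottom (t ∷ ts) l (b ∷ bs) ((_ , e) , c) zero    = e
row-bottom (t ∷ ts) l (b ∷ bs) (_ , c)       (suc j) = row-bottom ts _ bs c j

row-left : ∀ {m} (ts : Vec Tile m) l bs → RowConsistent ts l bs → ∀ j → toℕ j ≡ 0 → left (lookup ts j) ≡ is-just l
row-left (t ∷ ts) l (b ∷ bs) ((e , _) , c) zero _ = e

row-top : ∀ {m} (ts : Vec Tile m) l bs → RowConsistent ts l bs →
          ∀ j → is-just (lookup (proj₂ (propagateRow ts l bs)) j) ≡ top (lookup ts j)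
row-top (t ∷ ts) l (b ∷ bs) ((eₗ , e) , c) zero    = propagate-top t l b eₗ e
row-top (t ∷ ts) l (b ∷ bs) (_ , c)        (suc j) = row-top ts _ bs c j

row-right : ∀ {m} (ts : Vec Tile m) l bs → RowConsistent ts l bs →
            ∀ j → suc (toℕ j) ≡ m → right (lookup ts j) ≡ is-just (proj₁ (propagateRow ts l bs))
row-right (t ∷ [])      l (b ∷ []) ((eₗ , e) , c) zero    _  = ≡.sym (propagate-right t l b eₗ e)
row-right (t ∷ ts)      l (b ∷ bs) (_ , c)        (suc j) e  = row-right ts _ bs c j (ℕ.suc-injective e)

row-adjacent : ∀ {m} (ts : Vec Tile m) l bs → RowConsistent ts l bs →
               ∀ j j′ → toℕ j′ ≡ suc (toℕ j) → right (lookup ts j) ≡ left (lookup ts j′)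
row-adjacent (t ∷ ts) l (b ∷ bs) ((eₗ , e) , c) zero    (suc j′) adj =
  ≡.trans (≡.sym (propagate-right t l b eₗ e)) (≡.sym (row-left ts _ bs c j′ (ℕ.suc-injective adj)))
row-adjacent (t ∷ ts) l (b ∷ bs) (_ , c)        (suc j) (suc j′) adj = row-adjacent ts _ bs c j j′ (ℕ.suc-injective adj)

row-consistent : ∀ {m} (ts : Vec Tile m) l bs →
  (∀ j → toℕ j ≡ 0 → left (lookup ts j) ≡ is-just l) →
  (∀ j j′ → toℕ j′ ≡ suc (toℕ j) → right (lookup ts j) ≡ left (lookup ts j′)) →
  (∀ j → bottom (lookup ts j) ≡ is-just (lookup bs j)) → RowConsistent ts l bs
row-consistent []       l []       eₗ adj e = tt
row-consistent (t ∷ ts) l (b ∷ bs) eₗ adj e = (eₗ zero ≡.refl , e zero) , row-consistent ts _ bs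
  (λ j j≡0 → ≡.trans (≡.sym (adj zero (suc j) (≡.cong suc j≡0))) (≡.sym (propagate-right t l b (eₗ zero ≡.refl) (e zero))))
  (λ j j′ a → adj (suc j) (suc j′) (≡.cong suc a)) (e ∘ suc)

module _ {n : ℕ} where

  grid-row : ∀ {m} (T : Vec (Vec Tile n) m) bs → GridConsistent T bs → ∀ i →
    (∀ j → toℕ j ≡ 0 → left (lookup (lookup T i) j) ≡ false) ×
    (∀ j j′ → toℕ j′ ≡ suc (toℕ j) → right (lookup (lookup T i) j) ≡ left (lookup (lookup T i) j′)) ×
    (∀ j → suc (toℕ j) ≡ n → right (lookup (lookup T i) j) ≡ is-just (lookup (proj₁ (propagateRows T bs)) i))
  grid-row (R ∷ Rs) bs (g , c) zero = row-left R nothing _ c , row-adjacent R nothing _ c , row-right R nothing _ c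
  grid-row (R ∷ Rs) bs (g , _) (suc i) = grid-row Rs bs g i

  grid-bottom : ∀ {m} (T : Vec (Vec Tile n) m) bs → GridConsistent T bs → ∀ i j → suc (toℕ i) ≡ m →
                bottom (lookup (lookup T i) j) ≡ is-just (lookup bs j)
  grid-bottom (R ∷ []) bs (_ , c) zero    j e = row-bottom R nothing bs c j
  grid-bottom (R ∷ Rs) bs (g , _) (suc i) j e = grid-bottom Rs bs g i j (ℕ.suc-injective e)

  grid-top : ∀ {m} (T : Vec (Vec Tile n) m) bs → GridConsistent T bs → ∀ i j → toℕ i ≡ 0 →
             is-just (lookup (proj₂ (propagateRows T bs)) j) ≡ top (lookup (lookup T i) j)
  grid-top (R ∷ Rs) bs (_ , c) zero j _ = row-top R nothing _ c j

  grid-vertical : ∀ {m} (T : Vec (Vec Tile n) m) bs → GridConsistent T bs → ∀ i i′ j → toℕ i′ ≡ suc (toℕ i) →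
                  bottom (lookup (lookup T i) j) ≡ top (lookup (lookup T i′) j)
  grid-vertical (R ∷ Rs) bs (g , c) zero    (suc i′) j adj =
    ≡.trans (row-bottom R nothing _ c j) (grid-top Rs bs g i′ j (ℕ.suc-injective adj))
  grid-vertical (R ∷ Rs) bs (g , _) (suc i) (suc i′) j adj = grid-vertical Rs bs g i i′ j (ℕ.suc-injective adj)

  grid-consistent : ∀ {m} (T : Vec (Vec Tile n) m) bs →
    (∀ i j → toℕ j ≡ 0 → left (lookup (lookup T i) j) ≡ false) →
    (∀ i j j′ → toℕ j′ ≡ suc (toℕ j) → right (lookup (lookup T i) j) ≡ left (lookup (lookup T i) j′)) →
    (∀ i i′ j → toℕ i′ ≡ suc (toℕ i) → bottom (lookup (lookup T i) j) ≡ top (lookup (lookup T i′) j)) →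
    (∀ i j → suc (toℕ i) ≡ m → bottom (lookup (lookup T i) j) ≡ is-just (lookup bs j)) → GridConsistent T bs
  grid-consistent []       bs eₗ adj vert e = tt
  grid-consistent {suc m} (R ∷ Rs) bs eₗ adj vert e =
      rest , row-consistent R nothing _ (eₗ zero) (adj zero) (below Rs rest vert e)
    where
    rest : GridConsistent Rs bs
    rest = grid-consistent Rs bs (eₗ ∘ suc) (adj ∘ suc)
      (λ i i′ j a → vert (suc i) (suc i′) j (≡.cong suc a)) (λ i j e′ → e (suc i) j (≡.cong suc e′))
    -- Under `R` lies the bottom boundary if `Rs` is empty, and otherwise the top of the next row;
    -- generalising over `Rs` permits this split.
    below : ∀ {m} (Rs : Vec (Vec Tile n) m) → GridConsistent Rs bs →
      (∀ i i′ j → toℕ i′ ≡ suc (toℕ i) → bottom (lookup (lookup (R ∷ Rs) i) j) ≡ top (lookup (lookup (R ∷ Rs) i′) j)) →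
      (∀ i j → suc (toℕ i) ≡ suc m → bottom (lookup (lookup (R ∷ Rs) i) j) ≡ is-just (lookup bs j)) →
      ∀ j → bottom (lookup R j) ≡ is-just (lookup (proj₂ (propagateRows Rs bs)) j)
    below []        g vert e j = e zero j ≡.refl
    below (R′ ∷ Rs) g vert e j = ≡.trans (vert zero (suc zero) j ≡.refl) (≡.sym (grid-top (R′ ∷ Rs) bs g zero j ≡.refl))

allPresent : ∀ n → Vec Label n
allPresent n = tabulate (λ j → just (toℕ j))

labels-tabulate : ∀ m c → labels m c ≡ tabulate (λ j → just (c ℕ.+ toℕ j))
labels-tabulate zero    c = ≡.refl
labels-tabulate (suc m) c = ≡.cong₂ _∷_ (≡.cong just (≡.sym (ℕ.+-identityʳ c)))
  (≡.trans (labels-tabulate m (suc c)) (Vec.tabulate-cong λ j → ≡.cong just (≡.sym (ℕ.+-suc c (toℕ j)))))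

-- The left and bottom boundaries are built into the labels fed in, and the right boundary follows
-- from the labels that arrive; only the top needs a condition of its own.
Emerging : ∀ {n} → (Fin n → ℕ) → Tiling n → Set
Emerging {n} u T = GridConsistent T (allPresent n) ×
  (∀ i → lookup (proj₁ (propagateRows T (allPresent n))) i ≡ just (u i)) ×
  (∀ j → is-just (lookup (proj₂ (propagateRows T (allPresent n))) j) ≡ false)

present : ∀ n (j : Fin n) → is-just (lookup (allPresent n) j) ≡ true
present n j = ≡.cong is-just (Vec.lookup∘tabulate (λ j → just (toℕ j)) j)

pipe⇒emerging : ∀ {n} (w : Permutation′ n) T → IsBPD T × HasDemazureProduct w T → Emerging (λ i → toℕ (w ⟨$⟩ʳ i)) T
pipe⇒emerging {n} w T (bpd , dem) = g , dem , nothing-on-top T bpd g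
  where
  g : GridConsistent T (allPresent n)
  g = grid-consistent T (allPresent n) (IsBPD.leftBoundary bpd) (IsBPD.matchHorizontal bpd) (IsBPD.matchVertical bpd)
    (λ i j e → ≡.trans (IsBPD.bottomBoundary bpd i j e) (≡.sym (present n j)))
  nothing-on-top : ∀ {n} (T : Tiling n) → IsBPD T → GridConsistent T (allPresent n) →
                   ∀ j → is-just (lookup (proj₂ (propagateRows T (allPresent n))) j) ≡ false
  nothing-on-top {suc n} T bpd g j =
    ≡.trans (grid-top T (allPresent (suc n)) g zero j ≡.refl) (IsBPD.topBoundary bpd zero j ≡.refl)

emerging⇒pipe : ∀ {n} (w : Permutation′ n) T → Emerging (λ i → toℕ (w ⟨$⟩ʳ i)) T → IsBPD T × HasDemazureProduct w T
emerging⇒pipe {n} w T (g , dem , nothing-on-top) = record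
  { matchHorizontal = λ i → proj₁ (proj₂ (grid-row T bs g i))
  ; matchVertical   = grid-vertical T bs g
  ; bottomBoundary  = λ i j e → ≡.trans (grid-bottom T bs g i j e) (present n j)
  ; rightBoundary   = λ i j e → ≡.trans (proj₂ (proj₂ (grid-row T bs g i)) j e) (≡.cong is-just (dem i))
  ; leftBoundary    = λ i → proj₁ (grid-row T bs g i)
  ; topBoundary     = λ i j e → ≡.trans (≡.sym (grid-top T bs g i j e)) (nothing-on-top j)
  } , dem
  where
  bs = allPresent n

module _ {N : ℕ} where
  open CommutativeRing (polyRing N)
    using (setoid; commutativeSemiring; +-identityʳ; *-identityʳ; zeroʳ; zeroˡ; -‿inverseʳ;
      +-commutativeMonoid; *-commutativeMonoid)
  open import Algebra.Solver.Ring.NaturalCoefficients.Default commutativeSemiring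
    using (solve; _:+_; _:*_; _:=_; con)
  open import Relation.Binary.Reasoning.Setoid setoid
  open Sum *-commutativeMonoid using ()
    renaming (sum to prod; sum-cong-≋ to prod-cong; sum-replicate-zero to prod-one)
  private module ∑ = Fold +-commutativeMonoid
  private module ∏ = Fold *-commutativeMonoid

  -- Linear functionals

  -- `cong` stands in for function extensionality: observables are compared pointwise and up to
  -- `_≈_`.
  record Linear {A : Set} (φ : (A → Poly N) → Poly N) : Set where
    field
      cong     : ∀ {f g} → (∀ a → f a ≈ g a) → φ f ≈ φ g
      additive : ∀ f g → φ (λ a → f a + g a) ≈ φ f + φ g
      scaling  : ∀ c f → φ (λ a → c * f a) ≈ c * φ f

    vanish : φ (λ _ → 0#) ≈ 0#
    vanish = ≈-trans (cong (λ _ → ≈-sym (zeroˡ 0#))) (≈-trans (scaling 0# _) (zeroˡ _))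

  open Linear

  linear-eval : ∀ {A : Set} (a : A) → Linear (λ f → f a)
  linear-eval a = record { cong = λ e → e a ; additive = λ _ _ → ≈-refl ; scaling = λ _ _ → ≈-refl }

  linear-bind : ∀ {A B : Set} {φ : (A → Poly N) → Poly N} {ψ : A → (B → Poly N) → Poly N} →
                Linear φ → (∀ a → Linear (ψ a)) → Linear (λ f → φ (λ a → ψ a f))
  linear-bind Lφ Lψ = record
    { cong     = λ e → cong Lφ λ a → cong (Lψ a) e
    ; additive = λ f g → ≈-trans (cong Lφ λ a → additive (Lψ a) f g) (additive Lφ _ _)
    ; scaling  = λ c f → ≈-trans (cong Lφ λ a → scaling (Lψ a) c f) (scaling Lφ c _) }

  linear-map : ∀ {A B : Set} {φ : (A → Poly N) → Poly N} (h : A → B) →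
               Linear φ → Linear (λ f → φ (f ∘ h))
  linear-map h Lφ = linear-bind Lφ (linear-eval ∘ h)

  Combination : Set → Set
  Combination A = List (Poly N × A)

  ⟨_⟩ : ∀ {A : Set} → Combination A → (A → Poly N) → Poly N
  ⟨ L ⟩ f = ∑ (map (λ (c , a) → c * f a) L)

  linear-⟨⟩ : ∀ {A : Set} (L : Combination A) → Linear ⟨ L ⟩
  linear-⟨⟩ [] = record
    { cong = λ _ → ≈-refl ; additive = λ _ _ → ≈-sym (+-identityˡ 0#) ; scaling = λ c _ → ≈-sym (zeroʳ c) }
  linear-⟨⟩ ((d , a) ∷ L) = record
    { cong     = λ e → +-cong (*-cong ≈-refl (e a)) (cong (linear-⟨⟩ L) e)
    ; additive = λ f g → ≈-trans (+-cong ≈-refl (additive (linear-⟨⟩ L) f g))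
        (solve 5 (λ d f g p q → d :* (f :+ g) :+ (p :+ q) := (d :* f :+ p) :+ (d :* g :+ q))
          ≈-refl d (f a) (g a) _ _)
    ; scaling  = λ c f → ≈-trans (+-cong ≈-refl (scaling (linear-⟨⟩ L) c f))
        (solve 4 (λ c d f p → d :* (c :* f) :+ c :* p := c :* (d :* f :+ p)) ≈-refl c d (f a) _) }

  -- Interchange of summations. One functional is a finite combination; of the other only linearity
  -- is used.
  ⟨⟩-swap : ∀ {A B : Set} {φ : (B → Poly N) → Poly N} → Linear φ → (L : Combination A) (f : A → B → Poly N) →
            ⟨ L ⟩ (λ a → φ (f a)) ≈ φ (λ b → ⟨ L ⟩ (λ a → f a b))
  ⟨⟩-swap Lφ [] f = ≈-sym (vanish Lφ)
  ⟨⟩-swap Lφ ((c , a) ∷ L) f = ≈-sym (≈-trans (additive Lφ _ _)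
    (+-cong (scaling Lφ c _) (≈-sym (⟨⟩-swap Lφ L f))))

  -- The Yang–Baxter equation

  -- With X = 1 + β xᵢ and Y = 1 + β yⱼ one has 1 + β (xᵢ ⊕ yⱼ) = X Y.
  tileWeight : Poly N → Poly N → Tile → Poly N
  tileWeight X Y downElbow  = 1#
  tileWeight X Y upElbow    = X * Y
  tileWeight X Y crossing   = 1#
  tileWeight X Y blank      = X * Y - 1#
  tileWeight X Y horizontal = 1#
  tileWeight X Y vertical   = 1#

  -- Because the six tiles are filtered, `step` reduces to at most two terms once the presence of
  -- both labels is known, and it can be recognised inside the sum over all tilings in `step-tiles`.
  step : Poly N → Poly N → Label → Label → Combination (Label × Label)
  step X Y l b = map (λ t → tileWeight X Y t , propagate t l b) (filter (fits? (is-just l) (is-just b)) tiles)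

  -- The vertex attached at the left end of two adjacent rows with parameters
  -- P = Q + D (upper) and Q (lower) in the Yang–Baxter equation.
  R : Poly N → Poly N → Label × Label → Combination (Label × Label)
  R Q D (nothing , nothing) = (Q , nothing , nothing) ∷ []
  R Q D (l , l′)            = (Q , l , l′) ∷ (D , descending l l′) ∷ []

  column : Poly N → Poly N → Poly N → Label → Label × Label → ((Label × Label) × Label → Poly N) → Poly N
  column P Q Y b (l , l′) f =
    ⟨ step Q Y l′ b ⟩ λ (r′ , m) → ⟨ step P Y l m ⟩ λ (r , t) → f ((r , r′) , t)

  linear-column : ∀ P Q Y b ls → Linear (column P Q Y b ls)
  linear-column P Q Y b (l , l′) =
    linear-bind (linear-⟨⟩ (step Q Y l′ b)) λ (r′ , m) → linear-map _ (linear-⟨⟩ (step P Y l m))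

  private
    -- The semiring solver sees `- 1#`, from the weight of a blank, as a free atom `m`. In two of
    -- the Yang-Baxter cases the sides differ by a multiple of `D * (1# + m)`, which is removed by
    -- hand.
    d[1-1]≈0 : ∀ (d : Poly N) → d * (1# + - 1#) ≈ 0#
    d[1-1]≈0 d = ≈-trans (*-cong ≈-refl (-‿inverseʳ 1#)) (zeroʳ d)

  -- Eight cases, by the presence of the three incoming labels. In each the sums unfold to a
  -- polynomial identity in the weights and the values of `f`; the labels themselves matter only
  -- through the identities on minima and maxima.
  yang-baxter : ∀ Q D Y b ls f →
    ⟨ R Q D ls ⟩ (λ ms → column (Q + D) Q Y b ms f) ≈
    column Q (Q + D) Y b ls (λ (rs , t) → ⟨ R Q D rs ⟩ (λ rs′ → f (rs′ , t)))
  yang-baxter Q D Y nothing (nothing , nothing) f =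
    solve 5 (λ q d v m k → q :* ((q :* v :+ m) :* (((q :+ d) :* v :+ m) :* k :+ con 0) :+ con 0) :+ con 0
      := ((q :+ d) :* v :+ m) :* ((q :* v :+ m) :* (q :* k :+ con 0) :+ con 0) :+ con 0)
      ≈-refl Q D Y (- 1#) _
  yang-baxter Q D Y nothing (nothing , just c) f =
    solve 7 (λ q d v m k₁ k₂ k₃ →
      let p = q :+ d ; z = con 0 ; o = con 1
          C = (q :* v) :* (o :* k₁ :+ (o :* k₂ :+ z)) :+ (o :* ((p :* v :+ m) :* k₃ :+ z) :+ z)
      in q :* C :+ (d :* C :+ z)
      := (p :* v) :* (o :* (q :* k₁ :+ (d :* k₃ :+ z)) :+ (o :* (q :* k₂ :+ z) :+ z))
         :+ (o :* ((q :* v :+ m) :* (q :* k₃ :+ (d :* k₃ :+ z)) :+ z) :+ z))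
      ≈-refl Q D Y (- 1#) (f ((just c , nothing) , nothing)) (f ((nothing , nothing) , just c))
        (f ((nothing , just c) , nothing))
  yang-baxter Q D Y nothing (just a , nothing) f = ≈-trans
    (solve 7 (λ q d v m k₁ k₂ k₃ →
      let p = q :+ d ; z = con 0 ; o = con 1
      in q :* ((q :* v :+ m) :* ((p :* v) :* k₂ :+ (o :* k₁ :+ z)) :+ z)
         :+ (d :* ((q :* v) :* (o :* k₁ :+ (o :* k₂ :+ z)) :+ (o :* ((p :* v :+ m) :* k₃ :+ z) :+ z)) :+ z)
      := (p :* v :+ m) :* ((q :* v) :* (q :* k₂ :+ z) :+ (o :* (q :* k₁ :+ (d :* k₃ :+ z)) :+ z)) :+ z
         :+ (q :* v :* k₂) :* (d :* (o :+ m)))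
      ≈-refl Q D Y (- 1#) (f ((just a , nothing) , nothing)) (f ((nothing , nothing) , just a))
        (f ((nothing , just a) , nothing)))
    (≈-trans (+-cong ≈-refl (≈-trans (*-cong ≈-refl (d[1-1]≈0 D)) (zeroʳ _))) (+-identityʳ _))
  yang-baxter Q D Y nothing (just a , just c) f
    rewrite ⊔-⊓-⊓ a c | ⊔-⊔-⊓ a c =
    solve 8 (λ q d v k₁ k₂ k₃ k₄ k₅ →
      let p = q :+ d ; z = con 0 ; o = con 1
      in q :* ((q :* v) :* (o :* k₁ :+ z) :+ (o :* ((p :* v) :* k₂ :+ (o :* k₃ :+ z)) :+ z))
         :+ (d :* ((q :* v) :* (o :* k₁ :+ z) :+ (o :* ((p :* v) :* k₄ :+ (o :* k₅ :+ z)) :+ z)) :+ z)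
      := (p :* v) :* (o :* (q :* k₁ :+ (d :* k₄ :+ z)) :+ z)
         :+ (o :* ((q :* v) :* (q :* k₂ :+ (d :* k₂ :+ z)) :+ (o :* (q :* k₃ :+ (d :* k₅ :+ z)) :+ z)) :+ z))
      ≈-refl Q D Y (f ((just (a ⊓ c) , nothing) , just (a ⊔ c))) (f ((nothing , just c) , just a))
        (f ((just a , just c) , nothing)) (f ((nothing , just (a ⊓ c)) , just (a ⊔ c)))
        (f ((just (a ⊔ c) , just (a ⊓ c)) , nothing))
  yang-baxter Q D Y (just b) (nothing , nothing) f = ≈-trans
    (≈-sym (≈-trans (+-cong ≈-refl (≈-trans (*-cong ≈-refl (d[1-1]≈0 D)) (zeroʳ _))) (+-identityʳ _)))
    (solve 7 (λ q d v m k₁ k₂ k₃ →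
      let p = q :+ d ; z = con 0 ; o = con 1
      in q :* (o :* ((p :* v :+ m) :* k₃ :+ z) :+ (o :* (o :* k₁ :+ (o :* k₂ :+ z)) :+ z)) :+ z
         :+ k₃ :* (d :* (o :+ m))
      := o :* ((q :* v :+ m) :* (q :* k₃ :+ (d :* k₃ :+ z)) :+ z)
         :+ (o :* (o :* (q :* k₁ :+ (d :* k₃ :+ z)) :+ (o :* (q :* k₂ :+ z) :+ z)) :+ z))
      ≈-refl Q D Y (- 1#) (f ((just b , nothing) , nothing)) (f ((nothing , nothing) , just b))
        (f ((nothing , just b) , nothing)))
  yang-baxter Q D Y (just b) (nothing , just c) f
    rewrite ⊔-⊓-⊓ c b | ⊔-⊔-⊓ c b =
    solve 4 (λ q d k₁ k₂ →
      let z = con 0 ; o = con 1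
          C = o :* (o :* k₁ :+ (o :* k₂ :+ z)) :+ z
      in q :* C :+ (d :* C :+ z)
      := o :* (o :* (q :* k₁ :+ (d :* k₁ :+ z)) :+ (o :* (q :* k₂ :+ (d :* k₂ :+ z)) :+ z)) :+ z)
      ≈-refl Q D (f ((just (c ⊔ b) , just (c ⊓ b)) , nothing)) (f ((nothing , just (c ⊓ b)) , just (c ⊔ b)))
  yang-baxter Q D Y (just b) (just a , nothing) f =
    solve 8 (λ q d v k₁ k₂ k₃ k₄ k₅ →
      let p = q :+ d ; z = con 0 ; o = con 1
      in q :* (o :* ((p :* v) :* k₂ :+ (o :* k₃ :+ z)) :+ (o :* (o :* k₁ :+ z) :+ z))
         :+ (d :* (o :* (o :* k₅ :+ (o :* k₄ :+ z)) :+ z) :+ z)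
      := o :* ((q :* v) :* (q :* k₂ :+ (d :* k₂ :+ z)) :+ (o :* (q :* k₃ :+ (d :* k₅ :+ z)) :+ z))
         :+ (o :* (o :* (q :* k₁ :+ (d :* k₄ :+ z)) :+ z) :+ z))
      ≈-refl Q D Y (f ((just (a ⊓ b) , nothing) , just (a ⊔ b))) (f ((nothing , just b) , just a))
        (f ((just a , just b) , nothing)) (f ((nothing , just (a ⊓ b)) , just (a ⊔ b)))
        (f ((just (a ⊔ b) , just (a ⊓ b)) , nothing))
  yang-baxter Q D Y (just b) (just a , just c) f
    rewrite ⊔-⊓-join a c b | ⊔-⊓-median a c b | ⊓-⊔-⊓ a c b =
    solve 4 (λ q d k₁ k₂ →
      let z = con 0 ; o = con 1
      in q :* (o :* (o :* k₁ :+ z) :+ z) :+ (d :* (o :* (o :* k₂ :+ z) :+ z) :+ z)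
      := o :* (o :* (q :* k₁ :+ (d :* k₂ :+ z)) :+ z) :+ z)
      ≈-refl Q D (f ((just (a ⊓ (c ⊔ b)) , just (c ⊓ b)) , just (a ⊔ (c ⊔ b))))
        (f ((just ((a ⊓ (c ⊔ b)) ⊔ (c ⊓ b)) , just ((a ⊓ c) ⊓ b)) , just (a ⊔ (c ⊔ b))))

  -- Partition functions of rows and grids

  rowFunctional : ∀ {m} → Poly N → (Fin m → Poly N) → Label → Vec Label m → (Label × Vec Label m → Poly N) → Poly N
  rowFunctional X Y l []       f = f (l , [])
  rowFunctional X Y l (b ∷ bs) f =
    ⟨ step X (Y zero) l b ⟩ λ (r , t) → rowFunctional X (Y ∘ suc) r bs λ (r′ , ts) → f (r′ , t ∷ ts)

  linear-row : ∀ {m} X (Y : Fin m → Poly N) l bs → Linear (rowFunctional X Y l bs)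
  linear-row X Y l []       = linear-eval _
  linear-row X Y l (b ∷ bs) = linear-bind (linear-⟨⟩ (step X (Y zero) l b)) λ (r , t) →
    linear-map _ (linear-row X (Y ∘ suc) r bs)

  tileWeight-cong : ∀ {X X′ : Poly N} → X ≈ X′ → ∀ Y t → tileWeight X Y t ≈ tileWeight X′ Y t
  tileWeight-cong e Y downElbow  = ≈-refl
  tileWeight-cong e Y upElbow    = *-cong e ≈-refl
  tileWeight-cong e Y crossing   = ≈-refl
  tileWeight-cong e Y blank      = +-cong (*-cong e ≈-refl) ≈-refl
  tileWeight-cong e Y horizontal = ≈-refl
  tileWeight-cong e Y vertical   = ≈-refl

  step-cong : ∀ {X X′ : Poly N} → X ≈ X′ → ∀ Y l b f → ⟨ step X Y l b ⟩ f ≈ ⟨ step X′ Y l b ⟩ f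
  step-cong {X} {X′} e Y l b f = go (filter (fits? (is-just l) (is-just b)) tiles)
    where
    go : ∀ ts → ⟨ map (λ t → tileWeight X Y t , propagate t l b) ts ⟩ f
              ≈ ⟨ map (λ t → tileWeight X′ Y t , propagate t l b) ts ⟩ f
    go []       = ≈-refl
    go (t ∷ ts) = +-cong (*-cong (tileWeight-cong e Y t) ≈-refl) (go ts)

  row-cong : ∀ {X X′ : Poly N} → X ≈ X′ → ∀ {m} (Y : Fin m → Poly N) l bs f →
             rowFunctional X Y l bs f ≈ rowFunctional X′ Y l bs f
  row-cong e Y l []       f = ≈-refl
  row-cong {X} e Y l (b ∷ bs) f = ≈-trans
    (cong (linear-⟨⟩ (step X (Y zero) l b)) λ (r , t) → row-cong e (Y ∘ suc) r bs _)
    (step-cong e (Y zero) l b _)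

  -- P is the parameter of the upper row and Q that of the lower one, which the
  -- labels cross first.
  twoRows : ∀ {m} → Poly N → Poly N → (Fin m → Poly N) → Vec Label m → Label × Label →
            ((Label × Label) × Vec Label m → Poly N) → Poly N
  twoRows P Q Y bs (l , l′) f =
    rowFunctional Q Y l′ bs λ (r′ , ms) → rowFunctional P Y l ms λ (r , ts) → f ((r , r′) , ts)

  -- The lower row is traversed completely before the upper one starts. Splitting off a column
  -- therefore moves the first tile of the upper row ahead of the rest of the lower row, an
  -- interchange of sums.
  twoRows-∷ : ∀ {m} P Q (Y : Fin (suc m) → Poly N) b bs ls f →
              twoRows P Q Y (b ∷ bs) ls f ≈
              column P Q (Y zero) b ls (λ (ms , t) → twoRows P Q (Y ∘ suc) bs ms (λ (rs , ts) → f (rs , t ∷ ts)))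
  twoRows-∷ P Q Y b bs (l , l′) f = cong (linear-⟨⟩ (step Q (Y zero) l′ b)) λ (r′ , m) →
    ≈-sym (⟨⟩-swap (linear-row Q (Y ∘ suc) r′ bs) (step P (Y zero) l m) _)

  exchange : ∀ {m} Q D (Y : Fin m → Poly N) bs ls f →
             ⟨ R Q D ls ⟩ (λ ms → twoRows (Q + D) Q Y bs ms f) ≈
             twoRows Q (Q + D) Y bs ls (λ (rs , ts) → ⟨ R Q D rs ⟩ (λ rs′ → f (rs′ , ts)))
  exchange Q D Y []       ls f = ≈-refl
  exchange Q D Y (b ∷ bs) ls f = begin
    ⟨ R Q D ls ⟩ (λ ms → twoRows P Q Y (b ∷ bs) ms f)
      ≈⟨ cong (linear-⟨⟩ (R Q D ls)) (λ ms → twoRows-∷ P Q Y b bs ms f) ⟩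
    ⟨ R Q D ls ⟩ (λ ms → column P Q (Y zero) b ms (λ (ks , t) → twoRows P Q (Y ∘ suc) bs ks (f∷ t)))
      ≈⟨ yang-baxter Q D (Y zero) b ls _ ⟩
    column Q P (Y zero) b ls (λ (ms , t) → ⟨ R Q D ms ⟩ (λ ks → twoRows P Q (Y ∘ suc) bs ks (f∷ t)))
      ≈⟨ cong (linear-column Q P (Y zero) b ls) (λ (ms , t) → exchange Q D (Y ∘ suc) bs ms (f∷ t)) ⟩
    column Q P (Y zero) b ls (λ (ms , t) → twoRows Q P (Y ∘ suc) bs ms
      (λ (rs , ts) → ⟨ R Q D rs ⟩ (λ rs′ → f (rs′ , t ∷ ts))))
      ≈⟨ twoRows-∷ Q P Y b bs ls (λ (rs , ts) → ⟨ R Q D rs ⟩ (λ rs′ → f (rs′ , ts))) ⟨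
    twoRows Q P Y (b ∷ bs) ls (λ (rs , ts) → ⟨ R Q D rs ⟩ (λ rs′ → f (rs′ , ts))) ∎
    where
    P = Q + D
    f∷ : Label → (Label × Label) × Vec Label _ → Poly N
    f∷ t (rs , ts) = f (rs , t ∷ ts)

  gridFunctional : ∀ {m n} → (Fin m → Poly N) → (Fin n → Poly N) → Vec Label n →
                   (Vec Label m × Vec Label n → Poly N) → Poly N
  gridFunctional {zero}  X Y bs f = f ([] , bs)
  gridFunctional {suc m} X Y bs f = gridFunctional (X ∘ suc) Y bs λ (rs , ms) →
    rowFunctional (X zero) Y nothing ms λ (r , ts) → f (r ∷ rs , ts)

  linear-grid : ∀ {m n} (X : Fin m → Poly N) (Y : Fin n → Poly N) bs → Linear (gridFunctional X Y bs)
  linear-grid {zero}  X Y bs = linear-eval _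
  linear-grid {suc m} X Y bs = linear-bind (linear-grid (X ∘ suc) Y bs) λ (rs , ms) →
    linear-map _ (linear-row (X zero) Y nothing ms)

  grid-cong : ∀ {m n} {X X′ : Fin m → Poly N} → (∀ i → X i ≈ X′ i) → ∀ (Y : Fin n → Poly N) bs f →
              gridFunctional X Y bs f ≈ gridFunctional X′ Y bs f
  grid-cong {zero}          e Y bs f = ≈-refl
  grid-cong {suc m} {X = X} e Y bs f = ≈-trans
    (cong (linear-grid (X ∘ suc) Y bs) λ (rs , ms) → row-cong (e zero) Y nothing ms _)
    (grid-cong (e ∘ suc) Y bs _)

  R-at : ∀ {m} {i j : Fin m} → Poly N → Poly N → Adjacent i j → Vec Label m → (Vec Label m → Poly N) → Poly N
  R-at Q D here      (l ∷ l′ ∷ ls) f = ⟨ R Q D (l , l′) ⟩ λ (r , r′) → f (r ∷ r′ ∷ ls)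
  R-at Q D (there a) (l ∷ ls)      f = R-at Q D a ls λ rs → f (l ∷ rs)

  linear-R-at : ∀ {m} {i j : Fin m} Q D (a : Adjacent i j) ls → Linear (R-at Q D a ls)
  linear-R-at Q D here      (l ∷ l′ ∷ ls) = linear-map _ (linear-⟨⟩ (R Q D (l , l′)))
  linear-R-at Q D (there a) (l ∷ ls)      = linear-map _ (linear-R-at Q D a ls)

  R-at-swap : ∀ {m} {i j : Fin m} {B : Set} {φ : (B → Poly N) → Poly N} → Linear φ → ∀ Q D (a : Adjacent i j) ls
              (f : Vec Label m → B → Poly N) →
              R-at Q D a ls (λ rs → φ (f rs)) ≈ φ (λ b → R-at Q D a ls (λ rs → f rs b))
  R-at-swap Lφ Q D here      (l ∷ l′ ∷ ls) f = ⟨⟩-swap Lφ (R Q D (l , l′)) _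
  R-at-swap Lφ Q D (there a) (l ∷ ls)      f = R-at-swap Lφ Q D a ls _

  -- The factor `X j` is the weight of the vertex on the empty left boundary. Rows above the pair do
  -- not meet the vertex; `R-at-swap` takes it out past their sums. Giving `X′` by a pointwise
  -- condition lets the statement restrict to the grid without its top row.
  grid-exchange : ∀ {m n} {i j : Fin m} (a : Adjacent i j) {X X′ : Fin m → Poly N} D →
    X i ≈ X j + D → (∀ k → X′ k ≈ X (transpose i j ⟨$⟩ʳ k)) → ∀ (Y : Fin n → Poly N) bs f →
    X j * gridFunctional X Y bs f ≈
    gridFunctional X′ Y bs (λ (rs , ts) → R-at (X j) D a rs (λ rs′ → f (rs′ , ts)))
  grid-exchange {suc (suc m)} {n} here {X} {X′} D e swapped Y bs f = begin
    Q * gridFunctional X₂ Y bs (λ (rs , ms) → twoRows (X zero) Q Y ms (nothing , nothing) (f∷ rs))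
      ≈⟨ scaling L Q (λ (rs , ms) → twoRows (X zero) Q Y ms (nothing , nothing) (f∷ rs)) ⟨
    gridFunctional X₂ Y bs (λ (rs , ms) → Q * twoRows (X zero) Q Y ms (nothing , nothing) (f∷ rs))
      ≈⟨ cong L (λ (rs , ms) → two-rows rs ms) ⟩
    gridFunctional X₂ Y bs (λ (rs , ms) → twoRows (X′ zero) (X′ (suc zero)) Y ms (nothing , nothing) (Rf∷ rs))
      ≈⟨ grid-cong (λ k → ≈-sym (swapped (suc (suc k)))) Y bs _ ⟩
    gridFunctional X₂′ Y bs (λ (rs , ms) → twoRows (X′ zero) (X′ (suc zero)) Y ms (nothing , nothing) (Rf∷ rs)) ∎
    where
    Q = X (suc zero)
    X₂ X₂′ : Fin m → Poly N
    X₂ k = X (suc (suc k))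
    X₂′ k = X′ (suc (suc k))
    L = linear-grid X₂ Y bs
    f∷ Rf∷ : Vec Label m → (Label × Label) × Vec Label n → Poly N
    f∷ rs ((r , r′) , ts) = f (r ∷ r′ ∷ rs , ts)
    Rf∷ rs (ls , ts) = ⟨ R Q D ls ⟩ λ rs′ → f∷ rs (rs′ , ts)
    two-rows : ∀ rs ms → Q * twoRows (X zero) Q Y ms (nothing , nothing) (f∷ rs)
             ≈ twoRows (X′ zero) (X′ (suc zero)) Y ms (nothing , nothing) (Rf∷ rs)
    two-rows rs ms = begin
      Q * twoRows (X zero) Q Y ms (nothing , nothing) (f∷ rs)
        ≈⟨ *-cong ≈-refl (cong (linear-row Q Y nothing ms) λ (r′ , ms′) → row-cong e Y nothing ms′ _) ⟩
      Q * twoRows (Q + D) Q Y ms (nothing , nothing) (f∷ rs)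
        -- Here the vertex appears: on two empty edges it is the single term of weight `Q`.
        ≈⟨ +-identityʳ _ ⟨
      ⟨ R Q D (nothing , nothing) ⟩ (λ ls → twoRows (Q + D) Q Y ms ls (f∷ rs))
        ≈⟨ exchange Q D Y ms (nothing , nothing) (f∷ rs) ⟩
      twoRows Q (Q + D) Y ms (nothing , nothing) (Rf∷ rs)
        ≈⟨ row-cong (≈-trans (≈-sym e) (≈-sym (swapped (suc zero)))) Y nothing ms _ ⟩
      twoRows Q (X′ (suc zero)) Y ms (nothing , nothing) (Rf∷ rs)
        ≈⟨ cong (linear-row (X′ (suc zero)) Y nothing ms) (λ (r′ , ms′) → row-cong (≈-sym (swapped zero)) Y nothing ms′ _) ⟩
      twoRows (X′ zero) (X′ (suc zero)) Y ms (nothing , nothing) (Rf∷ rs) ∎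
  grid-exchange {suc m} {n} {suc i} {suc j} (there a) {X} {X′} D e swapped Y bs f = begin
    Q * gridFunctional (X ∘ suc) Y bs (λ (rs , ms) → rowFunctional (X zero) Y nothing ms (f∷ rs))
      ≈⟨ grid-exchange a D e swapped′ Y bs _ ⟩
    gridFunctional (X′ ∘ suc) Y bs (λ (rs , ms) → R-at Q D a rs (λ rs′ → rowFunctional (X zero) Y nothing ms (f∷ rs′)))
      ≈⟨ cong L′ (λ (rs , ms) → R-at-swap (linear-row (X zero) Y nothing ms) Q D a rs f∷) ⟩
    gridFunctional (X′ ∘ suc) Y bs (λ (rs , ms) → rowFunctional (X zero) Y nothing ms
      (λ (r , ts) → R-at Q D a rs (λ rs′ → f (r ∷ rs′ , ts))))
      ≈⟨ cong L′ (λ (rs , ms) → row-cong (≈-sym (swapped zero)) Y nothing ms _) ⟩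
    gridFunctional (X′ ∘ suc) Y bs (λ (rs , ms) → rowFunctional (X′ zero) Y nothing ms
      (λ (r , ts) → R-at Q D a rs (λ rs′ → f (r ∷ rs′ , ts)))) ∎
    where
    Q = X (suc j)
    L′ = linear-grid (X′ ∘ suc) Y bs
    f∷ : Vec Label m → Label × Vec Label n → Poly N
    f∷ rs (r , ts) = f (r ∷ rs , ts)
    swapped′ : ∀ k → X′ (suc k) ≈ X (suc (transpose i j ⟨$⟩ʳ k))
    swapped′ k = ≡.subst (λ k′ → X′ (suc k) ≈ X k′) (transpose-suc i j k) (swapped (suc k))

  -- Indicators of prescribed boundary labels

  ⟦_⟧ : Bool → Poly N
  ⟦ b ⟧ = if b then 1# else 0#

  _is_ : Label → ℕ → Poly N
  l is a = ⟦ does (Maybe.≡-dec ℕ._≟_ l (just a)) ⟧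

  -- A product over rows, so that the factors of two adjacent rows can be isolated for `R-matching`.
  matching : ∀ {m} → (Fin m → ℕ) → Vec Label m → Poly N
  matching u []       = 1#
  matching u (r ∷ rs) = (r is u zero) * matching (u ∘ suc) rs

  matching-cong : ∀ {m} {u v : Fin m → ℕ} → (∀ i → u i ≡ v i) → ∀ rs → matching u rs ≈ matching v rs
  matching-cong e []       = ≈-refl
  matching-cong e (r ∷ rs) rewrite e zero = *-cong ≈-refl (matching-cong (e ∘ suc) rs)

  is-yes : ∀ a → just a is a ≈ 1#
  is-yes a rewrite dec-true (Maybe.≡-dec ℕ._≟_ (just a) (just a)) ≡.refl = ≈-refl

  is-no : ∀ {a b} → a ≢ b → just a is b ≈ 0#
  is-no {a} {b} a≢b rewrite dec-false (Maybe.≡-dec ℕ._≟_ (just a) (just b)) (a≢b ∘ Maybe.just-injective) = ≈-refl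

  misordered : ∀ a b c d → a < b → c ≤ d → (just c is b) * (just d is a) ≈ 0#
  misordered a b c d a<b c≤d with c ℕ.≟ b
  ... | no c≢b = ≈-trans (*-cong (is-no c≢b) ≈-refl) (zeroˡ _)
  ... | yes ≡.refl = ≈-trans (*-cong ≈-refl (is-no d≢a)) (zeroʳ (just b is b))
    where
    d≢a : d ≢ a
    d≢a ≡.refl = ℕ.<⇒≱ a<b c≤d

  -- Sorting forgets the order. Of the two terms on the right, the one incompatible with the order
  -- of `c` and `d` vanishes by `misordered`.
  is-descending : ∀ a b c d → a < b →
    (just (c ⊔ d) is b) * (just (c ⊓ d) is a) ≈ (just c is b) * (just d is a) + (just c is a) * (just d is b)
  is-descending a b c d a<b with ℕ.≤-total c d
  ... | inj₁ c≤d rewrite ℕ.m≤n⇒m⊔n≡n c≤d | ℕ.m≤n⇒m⊓n≡m c≤d = ≈-sym (≈-trans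
    (+-cong (misordered a b c d a<b c≤d) (*-comm _ _)) (+-identityˡ _))
  ... | inj₂ d≤c rewrite ℕ.m≥n⇒m⊔n≡m d≤c | ℕ.m≥n⇒m⊓n≡n d≤c = ≈-sym (≈-trans
    (+-cong ≈-refl (≈-trans (*-comm _ _) (misordered a b d c a<b d≤c))) (+-identityʳ _))

  -- The order `(b , a)` is reached by keeping the pair, with weight `Q`, and by sorting it, with
  -- weight `D`; the order `(a , b)` by sorting alone. Hence the coefficients of the terms for `w`
  -- and `w sᵢ`.
  R-matching : ∀ Q D a b l l′ → a < b →
    ⟨ R Q D (l , l′) ⟩ (λ (r , r′) → (r is b) * (r′ is a))
    ≈ (Q + D) * ((l is b) * (l′ is a)) + D * ((l is a) * (l′ is b))
  R-matching Q D a b nothing  nothing  a<b =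
    solve 2 (λ q d → let z = con 0 in q :* (z :* z) :+ z := (q :+ d) :* (z :* z) :+ d :* (z :* z)) ≈-refl Q D
  R-matching Q D a b nothing  (just d) a<b =
    solve 4 (λ q d k k′ → let z = con 0 in q :* (z :* k) :+ (d :* (z :* k) :+ z) := (q :+ d) :* (z :* k) :+ d :* (z :* k′))
      ≈-refl Q D (just d is a) (just d is b)
  R-matching Q D a b (just c) nothing  a<b =
    solve 4 (λ q d k k′ → let z = con 0 in q :* (k :* z) :+ (d :* (z :* k′) :+ z) := (q :+ d) :* (k :* z) :+ d :* (k′ :* z))
      ≈-refl Q D (just c is b) (just c is a)
  R-matching Q D a b (just c) (just d) a<b = ≈-trans
    (+-cong ≈-refl (+-cong (*-cong ≈-refl (is-descending a b c d a<b)) ≈-refl))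
    (solve 4 (λ q d k k′ → q :* k :+ (d :* (k :+ k′) :+ con 0) := (q :+ d) :* k :+ d :* k′) ≈-refl Q D _ _)

  R-at-matching : ∀ {m} {i j : Fin m} (a : Adjacent i j) Q D (u v : Fin m → ℕ) rs →
    u j < u i → (∀ k → v k ≡ u (transpose i j ⟨$⟩ʳ k)) →
    R-at Q D a rs (matching u) ≈ (Q + D) * matching u rs + D * matching v rs
  R-at-matching here Q D u v (l ∷ l′ ∷ ls) u< swapped = begin
    ⟨ R Q D (l , l′) ⟩ (λ (r , r′) → (r is u zero) * ((r′ is u (suc zero)) * M))
      ≈⟨ cong L (λ (r , r′) → solve 3 (λ a b c → a :* (b :* c) := c :* (a :* b)) ≈-refl (r is u zero) (r′ is u (suc zero)) M) ⟩
    ⟨ R Q D (l , l′) ⟩ (λ (r , r′) → M * ((r is u zero) * (r′ is u (suc zero))))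
      ≈⟨ scaling L M (λ (r , r′) → (r is u zero) * (r′ is u (suc zero))) ⟩
    M * ⟨ R Q D (l , l′) ⟩ (λ (r , r′) → (r is u zero) * (r′ is u (suc zero)))
      ≈⟨ *-cong ≈-refl (R-matching Q D _ _ l l′ u<) ⟩
    M * ((Q + D) * ((l is u zero) * (l′ is u (suc zero))) + D * ((l is u (suc zero)) * (l′ is u zero)))
      ≈⟨ solve 7 (λ m p d a b a′ b′ →
           m :* (p :* (a :* b) :+ d :* (a′ :* b′)) := p :* (a :* (b :* m)) :+ d :* (a′ :* (b′ :* m))) ≈-refl _ _ _ _ _ _ _ ⟩
    (Q + D) * ((l is u zero) * ((l′ is u (suc zero)) * M)) + D * ((l is u (suc zero)) * ((l′ is u zero) * M))
      ≈⟨ +-cong ≈-refl (*-cong ≈-refl (matching-cong (λ k → ≡.sym (swapped k)) (l ∷ l′ ∷ ls))) ⟩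
    (Q + D) * matching u (l ∷ l′ ∷ ls) + D * matching v (l ∷ l′ ∷ ls) ∎
    where
    M = matching (λ k → u (suc (suc k))) ls
    L = linear-⟨⟩ (R Q D (l , l′))
  R-at-matching {i = suc i} {suc j} (there a) Q D u v (l ∷ ls) u< swapped = begin
    R-at Q D a ls (λ rs → (l is u zero) * matching (u ∘ suc) rs)
      ≈⟨ scaling (linear-R-at Q D a ls) (l is u zero) (matching (u ∘ suc)) ⟩
    (l is u zero) * R-at Q D a ls (matching (u ∘ suc))
      ≈⟨ *-cong ≈-refl (R-at-matching a Q D (u ∘ suc) (v ∘ suc) ls u< swapped′) ⟩
    (l is u zero) * ((Q + D) * matching (u ∘ suc) ls + D * matching (v ∘ suc) ls)
      ≈⟨ solve 5 (λ c p d s t → c :* (p :* s :+ d :* t) := p :* (c :* s) :+ d :* (c :* t)) ≈-refl _ _ _ _ _ ⟩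
    (Q + D) * matching u (l ∷ ls) + D * ((l is u zero) * matching (v ∘ suc) ls)
      ≡⟨ ≡.cong (λ a → (Q + D) * matching u (l ∷ ls) + D * ((l is a) * matching (v ∘ suc) ls)) (≡.sym (swapped zero)) ⟩
    (Q + D) * matching u (l ∷ ls) + D * matching v (l ∷ ls) ∎
    where
    swapped′ : ∀ k → v (suc k) ≡ u (suc (transpose i j ⟨$⟩ʳ k))
    swapped′ k = ≡.trans (swapped (suc k)) (≡.cong u (transpose-suc i j k))

  none : ∀ {m} → Vec Label m → Poly N
  none []       = 1#
  none (l ∷ ls) = ⟦ does (is-just l Bool.≟ false) ⟧ * none ls

  -- The partition function with n labels entering at the bottom, of which u i
  -- leaves through row i and none through the top.
  partition : ∀ {n} → (Fin n → Poly N) → (Fin n → Poly N) → (Fin n → ℕ) → Poly N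
  partition {n} X Y u = gridFunctional X Y (labels n 0) λ (rs , ts) → matching u rs * none ts

  partition-cong : ∀ {n} (X Y : Fin n → Poly N) {u v : Fin n → ℕ} → (∀ i → u i ≡ v i) → partition X Y u ≈ partition X Y v
  partition-cong X Y e = cong (linear-grid X Y _) λ (rs , ts) → *-cong (matching-cong e rs) ≈-refl

  partition-exchange : ∀ {n} {i j : Fin n} → Adjacent i j → ∀ {X X′ : Fin n → Poly N} Y D (u v : Fin n → ℕ) →
    X i ≈ X j + D → (∀ k → X′ k ≈ X (transpose i j ⟨$⟩ʳ k)) →
    u j < u i → (∀ k → v k ≡ u (transpose i j ⟨$⟩ʳ k)) →
    X j * partition X Y u ≈ X i * partition X′ Y u + D * partition X′ Y v
  partition-exchange {n} {i} {j} a {X} {X′} Y D u v e swapped u< uv = begin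
    X j * partition X Y u
      ≈⟨ grid-exchange a D e swapped Y (labels n 0) _ ⟩
    gridFunctional X′ Y (labels n 0) (λ (rs , ts) → R-at (X j) D a rs (λ rs′ → matching u rs′ * none ts))
      ≈⟨ cong L (λ (rs , ts) → pointwise rs ts) ⟩
    gridFunctional X′ Y (labels n 0) (λ (rs , ts) → X i * (matching u rs * none ts) + D * (matching v rs * none ts))
      ≈⟨ ≈-trans (additive L _ _) (+-cong (scaling L (X i) _) (scaling L D _)) ⟩
    X i * partition X′ Y u + D * partition X′ Y v ∎
    where
    L = linear-grid X′ Y (labels n 0)
    pointwise : ∀ rs ts → R-at (X j) D a rs (λ rs′ → matching u rs′ * none ts)
              ≈ X i * (matching u rs * none ts) + D * (matching v rs * none ts)
    pointwise rs ts = begin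
      R-at (X j) D a rs (λ rs′ → matching u rs′ * none ts)
        ≈⟨ cong (linear-R-at (X j) D a rs) (λ rs′ → *-comm _ _) ⟩
      R-at (X j) D a rs (λ rs′ → none ts * matching u rs′)
        ≈⟨ scaling (linear-R-at (X j) D a rs) (none ts) (matching u) ⟩
      none ts * R-at (X j) D a rs (matching u)
        ≈⟨ *-cong ≈-refl (R-at-matching a (X j) D u v rs u< uv) ⟩
      none ts * ((X j + D) * matching u rs + D * matching v rs)
        ≈⟨ *-cong ≈-refl (+-cong (*-cong (≈-sym e) ≈-refl) ≈-refl) ⟩
      none ts * (X i * matching u rs + D * matching v rs)
        ≈⟨ solve 5 (λ m p d s t → m :* (p :* s :+ d :* t) := p :* (s :* m) :+ d :* (t :* m)) ≈-refl _ _ _ _ _ ⟩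
      X i * (matching u rs * none ts) + D * (matching v rs * none ts) ∎

  -- Divided differences of the partition function

  substX-^ : ∀ σ k → substX σ (β⁻¹ {N} ^ k) ≡ β⁻¹ ^ k
  substX-^ σ zero    = ≡.refl
  substX-^ σ (suc k) = ≡.cong (β⁻¹ *_) (substX-^ σ k)

  module _ (σ : Fin N → Poly N) where

    substX-tileWeight : ∀ X Y t → substX σ (tileWeight X Y t) ≈ tileWeight (substX σ X) (substX σ Y) t
    substX-tileWeight X Y downElbow  = ≈-refl
    substX-tileWeight X Y upElbow    = ≈-refl
    substX-tileWeight X Y crossing   = ≈-refl
    substX-tileWeight X Y blank      = ≈-refl
    substX-tileWeight X Y horizontal = ≈-refl
    substX-tileWeight X Y vertical   = ≈-refl

    substX-step : ∀ X Y l b f → substX σ (⟨ step X Y l b ⟩ f) ≈ ⟨ step (substX σ X) (substX σ Y) l b ⟩ (substX σ ∘ f)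
    substX-step X Y l b f = go (filter (fits? (is-just l) (is-just b)) tiles)
      where
      go : ∀ ts → substX σ (⟨ map (λ t → tileWeight X Y t , propagate t l b) ts ⟩ f)
                ≈ ⟨ map (λ t → tileWeight (substX σ X) (substX σ Y) t , propagate t l b) ts ⟩ (substX σ ∘ f)
      go []       = ≈-refl
      go (t ∷ ts) = +-cong (*-cong (substX-tileWeight X Y t) ≈-refl) (go ts)

    substX-row : ∀ {m} X (Y : Fin m → Poly N) l bs f →
                 substX σ (rowFunctional X Y l bs f) ≈ rowFunctional (substX σ X) (substX σ ∘ Y) l bs (substX σ ∘ f)
    substX-row X Y l []       f = ≈-refl
    substX-row X Y l (b ∷ bs) f = ≈-trans (substX-step X (Y zero) l b _)
      (cong (linear-⟨⟩ (step (substX σ X) (substX σ (Y zero)) l b)) λ (r , t) → substX-row X (Y ∘ suc) r bs _)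

    substX-grid : ∀ {m n} (X : Fin m → Poly N) (Y : Fin n → Poly N) bs f →
                  substX σ (gridFunctional X Y bs f) ≈ gridFunctional (substX σ ∘ X) (substX σ ∘ Y) bs (substX σ ∘ f)
    substX-grid {zero}  X Y bs f = ≈-refl
    substX-grid {suc m} X Y bs f = ≈-trans (substX-grid (X ∘ suc) Y bs _)
      (cong (linear-grid (substX σ ∘ X ∘ suc) (substX σ ∘ Y) bs) λ (rs , ms) → substX-row (X zero) Y nothing ms _)

    substX-⟦⟧ : ∀ b → substX σ ⟦ b ⟧ ≈ ⟦ b ⟧
    substX-⟦⟧ true  = ≈-refl
    substX-⟦⟧ false = ≈-refl

    substX-matching : ∀ {m} (u : Fin m → ℕ) rs → substX σ (matching u rs) ≈ matching u rs
    substX-matching u []       = ≈-refl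
    substX-matching u (r ∷ rs) = *-cong (substX-⟦⟧ (does (Maybe.≡-dec ℕ._≟_ r (just (u zero))))) (substX-matching (u ∘ suc) rs)

    substX-none : ∀ {m} (ls : Vec Label m) → substX σ (none ls) ≈ none ls
    substX-none []       = ≈-refl
    substX-none (l ∷ ls) = *-cong (substX-⟦⟧ (does (is-just l Bool.≟ false))) (substX-none ls)

    substX-partition : ∀ {n} (X Y : Fin n → Poly N) u →
                       substX σ (partition X Y u) ≈ partition (substX σ ∘ X) (substX σ ∘ Y) u
    substX-partition {n} X Y u = ≈-trans (substX-grid X Y (labels n 0) (λ (rs , ts) → matching u rs * none ts))
      (cong (linear-grid (substX σ ∘ X) (substX σ ∘ Y) (labels n 0)) λ (rs , ts) →
        *-cong (substX-matching u rs) (substX-none ts))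

  X₀ Y₀ : Fin N → Poly N
  X₀ i = 1# + β * x i
  Y₀ j = 1# + β * y j

  Z : Permutation′ N → Poly N
  Z w = partition X₀ Y₀ (λ i → toℕ (w ⟨$⟩ʳ i))

  Z-exchange : ∀ {i j : Fin N} → Adjacent i j → ∀ w v → w ⟨$⟩ʳ j Fin.< w ⟨$⟩ʳ i → v Perm.≈ (transpose i j ∘ₚ w) →
               X₀ i * (transpose i j · Z w) ≈ X₀ j * Z w + (X₀ j - X₀ i) * Z v
  Z-exchange {i} {j} a w v w< v≈ = begin
    X₀ i * (s · Z w)
      ≈⟨ *-cong ≈-refl (substX-partition _ X₀ Y₀ (λ k → toℕ (w ⟨$⟩ʳ k))) ⟩
    X₀ i * partition sX Y₀ (λ k → toℕ (w ⟨$⟩ʳ k))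
      ≡⟨ ≡.cong (λ k → X₀ k * partition sX Y₀ (λ k → toℕ (w ⟨$⟩ʳ k))) (≡.sym (transpose-second a)) ⟩
    sX j * partition sX Y₀ (λ k → toℕ (w ⟨$⟩ʳ k))
      -- The permuted parameters serve as `X` and `X₀` as `X′`, so that the action of `s` stays on
      -- one side; the factor `sX j` is `X₀ i`.
      ≈⟨ partition-exchange a {X = sX} {X′ = X₀} Y₀ (X₀ j - X₀ i) (λ k → toℕ (w ⟨$⟩ʳ k)) (λ k → toℕ (v ⟨$⟩ʳ k)) sX≈
           (λ k → ≡⇒≈ (≡.cong X₀ (≡.sym (transpose-twice a k)))) w<
           (λ k → ≡.cong toℕ (v≈ k)) ⟩
    sX i * Z w + (X₀ j - X₀ i) * Z v
      ≡⟨ ≡.cong (λ k → X₀ k * Z w + (X₀ j - X₀ i) * Z v) (transpose-first a) ⟩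
    X₀ j * Z w + (X₀ j - X₀ i) * Z v ∎
    where
    s = transpose i j
    sX : Fin N → Poly N
    sX k = X₀ (s ⟨$⟩ʳ k)
    ≡⇒≈ : ∀ {f g : Poly N} → f ≡ g → f ≈ g
    ≡⇒≈ ≡.refl = ≈-refl
    sX≈ : sX i ≈ sX j + (X₀ j - X₀ i)
    sX≈ rewrite transpose-first a | transpose-second a = ≈-sym (begin
      X₀ i + (X₀ j - X₀ i)    ≈⟨ solve 3 (λ a b c → a :+ (b :+ c) := b :+ (a :+ c)) ≈-refl (X₀ i) (X₀ j) (- X₀ i) ⟩
      X₀ j + (X₀ i - X₀ i)    ≈⟨ +-cong ≈-refl (-‿inverseʳ (X₀ i)) ⟩
      X₀ j + 0#               ≈⟨ +-identityʳ _ ⟩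
      X₀ j                    ∎)

  β⁻¹^*β^ : ∀ k → β⁻¹ ^ k * β ^ k ≈ 1# {N}
  β⁻¹^*β^ zero    = *-identityˡ 1#
  β⁻¹^*β^ (suc k) = begin
    (β⁻¹ * β⁻¹ ^ k) * (β * β ^ k)  ≈⟨ solve 4 (λ a p b q → (a :* p) :* (b :* q) := (b :* a) :* (p :* q)) ≈-refl β⁻¹ _ β _ ⟩
    (β * β⁻¹) * (β⁻¹ ^ k * β ^ k)  ≈⟨ *-cong β-inverse (β⁻¹^*β^ k) ⟩
    1# * 1#                        ≈⟨ *-identityˡ 1# ⟩
    1#                             ∎

  π-cong : ∀ (i j : Fin N) {f g} → f ≈ g → π i j f ≈ π i j g
  π-cong i j e = quotient-cong i j (+-cong (*-cong (≈-refl {f = 1# + β * x j}) e)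
    (-‿cong (*-cong (≈-refl {f = 1# + β * x i}) (substX-cong _ e))))

  -- `Z-exchange` makes the numerator of `π` an explicit multiple of `x i - x j`: the difference
  -- `X₀ j - X₀ i` is `β` times `x j - x i`, and this `β` uses up one power of `β⁻¹`.
  π-Z : ∀ {i j : Fin N} → Adjacent i j → ∀ w v → w ⟨$⟩ʳ j Fin.< w ⟨$⟩ʳ i → v Perm.≈ (transpose i j ∘ₚ w) →
        π i j (β⁻¹ ^ suc (ℓ v) * Z w) ≈ β⁻¹ ^ ℓ v * Z v
  π-Z {i} {j} a w v w< v≈ = quotient-exact i≢j (begin
    (x i - x j) * (B * Z v)
      -- The subtracted term is moved across to leave an identity suited to a semiring solver.
      ≈⟨ move _ _ _ key ⟩
    X₀ j * (B′ * Z w) - B′ * (X₀ j * Z w + d * Z v)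
      ≈⟨ +-cong ≈-refl (-‿cong (*-cong ≈-refl (Z-exchange a w v w< v≈))) ⟨
    X₀ j * (B′ * Z w) - B′ * (X₀ i * (s · Z w))
      ≈⟨ +-cong ≈-refl (-‿cong (solve 3 (λ a b c → a :* (b :* c) := b :* (a :* c)) ≈-refl B′ (X₀ i) (s · Z w))) ⟩
    X₀ j * (β⁻¹ * B * Z w) - X₀ i * (β⁻¹ * B * (s · Z w))
      ≡⟨ ≡.cong (λ p → X₀ j * (β⁻¹ * B * Z w) - X₀ i * (β⁻¹ * p * (s · Z w))) (≡.sym (substX-^ _ (ℓ v))) ⟩
    X₀ j * (β⁻¹ ^ suc (ℓ v) * Z w) - X₀ i * (s · (β⁻¹ ^ suc (ℓ v) * Z w)) ∎)
    where
    s = transpose i j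
    B B′ d : Poly N
    B = β⁻¹ ^ ℓ v
    B′ = β⁻¹ * B
    d = X₀ j - X₀ i
    move : ∀ (f g h : Poly N) → f + h ≈ g → f ≈ g - h
    move f g h e = begin
      f            ≈⟨ +-identityʳ f ⟨
      f + 0#       ≈⟨ +-cong ≈-refl (-‿inverseʳ h) ⟨
      f + (h - h)  ≈⟨ +-assoc f h (- h) ⟨
      (f + h) - h  ≈⟨ +-cong e ≈-refl ⟩
      g - h        ∎
    key : (x i - x j) * (B * Z v) + B′ * (X₀ j * Z w + d * Z v) ≈ X₀ j * (B′ * Z w)
    key = begin
      (x i - x j) * (B * Z v) + B′ * (X₀ j * Z w + d * Z v)
        -- `B` is expanded to `β * β⁻¹ * B`, which exposes the common factor `B′`.
        ≈⟨ +-cong (*-cong ≈-refl (*-cong (≈-sym (≈-trans (*-cong β-inverse ≈-refl) (*-identityˡ B))) ≈-refl)) ≈-refl ⟩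
      (x i - x j) * ((β * β⁻¹ * B) * Z v) + B′ * (X₀ j * Z w + d * Z v)
        -- `- X₀ i` and `- x j` enter as the free atoms `a′` and `e′`; the cancellations that depend
        -- on their meaning are collected in the last factor.
        ≈⟨ solve 9 (λ a a′ e e′ c c⁻ b f g →
             let o = con 1 ; p = o :+ c :* e in
             (a :+ e′) :* ((c :* c⁻ :* b) :* g) :+ (c⁻ :* b) :* (p :* f :+ (p :+ a′) :* g)
             := p :* ((c⁻ :* b) :* f) :+ (c⁻ :* b :* g) :* (((o :+ c :* a) :+ a′) :+ c :* (e :+ e′)))
             ≈-refl (x i) (- X₀ i) (x j) (- x j) β β⁻¹ B (Z w) (Z v) ⟩
      X₀ j * (B′ * Z w) + (B′ * Z v) * ((X₀ i - X₀ i) + β * (x j - x j))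
        ≈⟨ +-cong ≈-refl (≈-trans (*-cong ≈-refl (≈-trans (+-cong (-‿inverseʳ (X₀ i))
             (≈-trans (*-cong ≈-refl (-‿inverseʳ (x j))) (zeroʳ β))) (+-identityˡ 0#))) (zeroʳ _)) ⟩
      X₀ j * (B′ * Z w) + 0#
        ≈⟨ +-identityʳ _ ⟩
      X₀ j * (B′ * Z w) ∎
    i≢j : i ≢ j
    i≢j ≡.refl = ℕ.<-irrefl ≡.refl w<

  -- The longest permutation

  -- Every bottom label is present, so each tile is a crossing, and the smaller label `a` keeps
  -- moving right.
  row-carry : ∀ {m} a c → a < c → ∀ X (Y : Fin m → Poly N) (f : Label × Vec Label m → Poly N) →
              rowFunctional X Y (just a) (labels m c) f ≈ f (just a , labels m c)
  row-carry {zero}  a c a<c X Y f = ≈-refl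
  row-carry {suc m} a c a<c X Y f rewrite ℕ.m≤n⇒m⊓n≡m (ℕ.<⇒≤ a<c) | ℕ.m≤n⇒m⊔n≡n (ℕ.<⇒≤ a<c) = begin
    1# * rowFunctional X (Y ∘ suc) (just a) (labels m (suc c)) (λ (r , ts) → f (r , just c ∷ ts)) + 0#
      ≈⟨ ≈-trans (+-identityʳ _) (*-identityˡ _) ⟩
    rowFunctional X (Y ∘ suc) (just a) (labels m (suc c)) (λ (r , ts) → f (r , just c ∷ ts))
      ≈⟨ row-carry a (suc c) (ℕ.m<n⇒m<1+n a<c) X (Y ∘ suc) _ ⟩
    f (just a , just c ∷ labels m (suc c)) ∎

  -- All labels still to come exceed `a`, so a carried label that is absent or above `a` never turns
  -- into `a`.
  row-avoids : ∀ {m} a c l → l Avoids a → a < c → ∀ X (Y : Fin m → Poly N) (g : Vec Label m → Poly N) →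
               rowFunctional X Y l (labels m c) (λ (r , ts) → (r is a) * g ts) ≈ 0#
  row-avoids {zero} a c _ absent       a<c X Y g = zeroˡ _
  row-avoids {zero} a c _ (larger a<d) a<c X Y g = ≈-trans (*-cong (is-no λ e → ℕ.<-irrefl (≡.sym e) a<d) ≈-refl) (zeroˡ _)
  row-avoids {suc m} a c _ absent a<c X Y g = ≈-trans
    (+-cong (*-cong ≈-refl (row-avoids a (suc c) (just c) (larger a<c) (ℕ.m<n⇒m<1+n a<c) X (Y ∘ suc) (g ∘ (nothing ∷_))))
      (+-cong (*-cong ≈-refl (row-avoids a (suc c) nothing absent (ℕ.m<n⇒m<1+n a<c) X (Y ∘ suc) (g ∘ (just c ∷_)))) ≈-refl))
    (solve 0 (con 1 :* con 0 :+ (con 1 :* con 0 :+ con 0) := con 0) ≈-refl)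
  row-avoids {suc m} a c (just d) (larger a<d) a<c X Y g = ≈-trans
    (+-cong (*-cong ≈-refl (row-avoids a (suc c) (just (d ⊓ c)) (larger (ℕ.⊓-glb a<d a<c)) (ℕ.m<n⇒m<1+n a<c)
      X (Y ∘ suc) (g ∘ (just (d ⊔ c) ∷_)))) ≈-refl)
    (solve 0 (con 1 :* con 0 :+ con 0 := con 0) ≈-refl)

  -- The first `r` tiles have no incoming pipe and are forced to be blank. In the next column `a`
  -- must turn right, since otherwise `row-avoids` applies, and then `row-carry` takes it to the end
  -- at weight 1.
  row-withoutFirst : ∀ r {m} → r < m → ∀ a c → c ℕ.+ r ≡ a → ∀ X (Y : Fin m → Poly N) (g : Vec Label m → Poly N) →
    rowFunctional X Y nothing (withoutFirst r m c) (λ (l , ts) → (l is a) * g ts) ≈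
    prod (λ j → if toℕ j <ᵇ r then X * Y j - 1# else 1#) * g (withoutFirst (suc r) m c)
  row-withoutFirst zero {suc m} r<m a c e X Y g rewrite ≡.trans (≡.sym (ℕ.+-identityʳ c)) e = begin
    1# * rowFunctional X (Y ∘ suc) (just a) (labels m (suc a)) (λ (l , ts) → (l is a) * g (nothing ∷ ts))
    + (1# * rowFunctional X (Y ∘ suc) nothing (labels m (suc a)) (λ (l , ts) → (l is a) * g (just a ∷ ts)) + 0#)
      ≈⟨ +-cong (*-cong ≈-refl (row-carry a (suc a) (ℕ.n<1+n a) X (Y ∘ suc) _))
           (+-cong (*-cong ≈-refl (row-avoids a (suc a) nothing absent (ℕ.n<1+n a) X (Y ∘ suc) (g ∘ (just a ∷_)))) ≈-refl) ⟩
    1# * ((just a is a) * G) + (1# * 0# + 0#)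
      ≈⟨ +-cong (*-cong ≈-refl (*-cong (is-yes a) ≈-refl)) ≈-refl ⟩
    1# * (1# * G) + (1# * 0# + 0#)
      ≈⟨ solve 1 (λ g → let o = con 1 ; z = con 0 in o :* (o :* g) :+ (o :* z :+ z) := o :* o :* g) ≈-refl G ⟩
    1# * 1# * G
      ≈⟨ *-cong (*-cong ≈-refl (prod-one m)) ≈-refl ⟨
    1# * prod {m} (λ _ → 1#) * G ∎
    where
    G = g (nothing ∷ labels m (suc a))
  row-withoutFirst (suc r) {suc m} (s≤s r<m) a c e X Y g = begin
    W * rowFunctional X (Y ∘ suc) nothing (withoutFirst r m (suc c)) (λ (l , ts) → (l is a) * g (nothing ∷ ts)) + 0#
      ≈⟨ +-cong (*-cong ≈-refl (row-withoutFirst r r<m a (suc c) (≡.trans (≡.sym (ℕ.+-suc c r)) e)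
           X (Y ∘ suc) (g ∘ (nothing ∷_)))) ≈-refl ⟩
    W * (prod (λ j → if toℕ j <ᵇ r then X * Y (suc j) - 1# else 1#) * G) + 0#
      ≈⟨ ≈-trans (+-identityʳ _) (≈-sym (*-assoc _ _ _)) ⟩
    W * prod (λ j → if toℕ j <ᵇ r then X * Y (suc j) - 1# else 1#) * G ∎
    where
    W = X * Y zero - 1#
    G = g (nothing ∷ withoutFirst (suc r) m (suc c))

  -- The induction removes the top row but no column, hence `m` rows and `n` columns. The value
  -- `opposite i` of a lower row survives this removal up to `inject₁`.
  grid-withoutFirst : ∀ {m n} → m ≤ n → ∀ X (Y : Fin n → Poly N) (g : Vec Label n → Poly N) →
    gridFunctional X Y (labels n 0) (λ (rs , ts) → matching (toℕ ∘ opposite {m}) rs * g ts) ≈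
    prod (λ i → prod (λ j → if toℕ j <ᵇ toℕ (opposite i) then X i * Y j - 1# else 1#)) * g (withoutFirst m n 0)
  grid-withoutFirst {zero}  m≤n X Y g = ≈-refl
  grid-withoutFirst {suc m} {n} m<n X Y g = begin
    gridFunctional (X ∘ suc) Y bs (λ (rs , ms) → rowFunctional (X zero) Y nothing ms
      (λ (r , ts) → ((r is a) * matching (toℕ ∘ opposite ∘ suc) rs) * g ts))
      ≈⟨ cong L (λ (rs , ms) → pointwise rs ms) ⟩
    gridFunctional (X ∘ suc) Y bs (λ (rs , ms) → matching (toℕ ∘ opposite) rs * g′ ms)
      ≈⟨ grid-withoutFirst (ℕ.<⇒≤ m<n) (X ∘ suc) Y g′ ⟩
    prod (λ i → prod (λ j → if toℕ j <ᵇ toℕ (opposite i) then X (suc i) * Y j - 1# else 1#)) * g′ (withoutFirst m n 0)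
      ≈⟨ *-cong (prod-cong λ i → prod-cong λ j → weight-cong i j)
           (row-withoutFirst m m<n a 0 (≡.sym (Fin.toℕ-fromℕ m)) (X zero) Y g) ⟩
    rest * (prod (λ j → if toℕ j <ᵇ m then X zero * Y j - 1# else 1#) * g (withoutFirst (suc m) n 0))
      ≡⟨ ≡.cong (λ r → rest * (prod (λ j → if toℕ j <ᵇ r then X zero * Y j - 1# else 1#) * g (withoutFirst (suc m) n 0)))
           (≡.sym (Fin.toℕ-fromℕ m)) ⟩
    rest * (first * g (withoutFirst (suc m) n 0))
      ≈⟨ solve 3 (λ p q r → p :* (q :* r) := q :* p :* r) ≈-refl rest first _ ⟩
    first * rest * g (withoutFirst (suc m) n 0) ∎
    where
    bs = labels n 0
    a = toℕ (opposite {suc m} zero)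
    L = linear-grid (X ∘ suc) Y bs
    first rest : Poly N
    first = prod (λ j → if toℕ j <ᵇ a then X zero * Y j - 1# else 1#)
    rest = prod (λ i → prod (λ j → if toℕ j <ᵇ toℕ (opposite {suc m} (suc i)) then X (suc i) * Y j - 1# else 1#))
    g′ : Vec Label n → Poly N
    g′ ms = rowFunctional (X zero) Y nothing ms (λ (r , ts) → (r is a) * g ts)
    weight-cong : ∀ i j → (if toℕ j <ᵇ toℕ (opposite i) then X (suc i) * Y j - 1# else 1#)
                  ≈ (if toℕ j <ᵇ toℕ (opposite {suc m} (suc i)) then X (suc i) * Y j - 1# else 1#)
    weight-cong i j rewrite Fin.toℕ-inject₁ (opposite i) = ≈-refl
    pointwise : ∀ rs ms → rowFunctional (X zero) Y nothing ms
                  (λ (r , ts) → ((r is a) * matching (toℕ ∘ opposite ∘ suc) rs) * g ts)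
                ≈ matching (toℕ ∘ opposite) rs * g′ ms
    pointwise rs ms = ≈-trans
      (cong (linear-row (X zero) Y nothing ms) λ (r , ts) → ≈-trans
        (*-cong (*-cong ≈-refl (matching-cong (λ i → Fin.toℕ-inject₁ (opposite i)) rs)) ≈-refl)
        (solve 3 (λ p q r → p :* q :* r := q :* (p :* r)) ≈-refl (r is a) _ (g ts)))
      (scaling (linear-row (X zero) Y nothing ms) (matching (toℕ ∘ opposite) rs) _)

  none-withoutFirst : ∀ m c → none (withoutFirst m m c) ≈ 1# {N}
  none-withoutFirst zero    c = ≈-refl
  none-withoutFirst (suc m) c = ≈-trans (*-identityˡ _) (none-withoutFirst m (suc c))

  X₀Y₀-1 : ∀ i j → X₀ i * Y₀ j - 1# ≈ β * (x i ⊕ y j)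
  X₀Y₀-1 i j = ≈-trans
    (solve 4 (λ a b c m → let o = con 1 in (o :+ c :* a) :* (o :+ c :* b) :+ m := c :* (a :+ b :+ c :* a :* b) :+ (o :+ m))
      ≈-refl (x i) (y j) β (- 1#))
    (≈-trans (+-cong ≈-refl (-‿inverseʳ 1#)) (+-identityʳ _))

  inStaircase? : Decidable (λ ((i , j) : Fin N × Fin N) → suc (toℕ i) ℕ.+ suc (toℕ j) ≤ N)
  inStaircase? (i , j) = suc (toℕ i) ℕ.+ suc (toℕ j) ℕ.≤? N

  staircaseCells : List (Fin N × Fin N)
  staircaseCells = filter inStaircase? (cells N)

  inStaircase-⇔ : ∀ (i j : Fin N) → (suc (toℕ i) ℕ.+ suc (toℕ j) ≤ N → toℕ j < toℕ (opposite i)) ×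
                                    (toℕ j < toℕ (opposite i) → suc (toℕ i) ℕ.+ suc (toℕ j) ≤ N)
  inStaircase-⇔ i j rewrite Fin.opposite-prop i | ℕ.+-comm (suc (toℕ i)) (suc (toℕ j)) =
    ℕ.m+n≤o⇒m≤o∸n (suc (toℕ j)) , ℕ.m≤o∸n⇒m+n≤o (suc (toℕ j)) (Fin.toℕ<n i)

  ∏-scale : ∀ {A : Set} c (f : A → Poly N) as → ∏ (map (λ a → c * f a) as) ≈ c ^ length as * ∏ (map f as)
  ∏-scale c f []       = ≈-sym (*-identityˡ 1#)
  ∏-scale c f (a ∷ as) = ≈-trans (*-cong ≈-refl (∏-scale c f as))
    (solve 4 (λ c f p q → c :* f :* (p :* q) := c :* p :* (f :* q)) ≈-refl c (f a) (c ^ length as) (∏ (map f as)))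

  -- Reversing the second position carries the inversions `(a , b)` of `w₀`, which are all pairs
  -- with `a < b`, to the staircase cells `(a , opposite b)`.
  ℓ-longest : ∀ w → w Perm.≈ reverse → ℓ w ≡ length staircaseCells
  ℓ-longest w w≈ = ≡.trans (length-filter-cells (isInversion? w))
    (≡.trans (sum-cong-≗ λ a → ≡.trans (sum-permute (λ b → count (isInversion? w (a , b))) (reverse {N}))
      (sum-cong-≗ λ j → count-⇔ (isInversion? w (a , opposite j)) (inStaircase? (a , j)) (to a j) (from a j)))
    (≡.sym (length-filter-cells inStaircase?)))
    where
    open Sum ℕ.+-0-commutativeMonoid
    to : ∀ a j → a Fin.< opposite j × w ⟨$⟩ʳ opposite j Fin.< w ⟨$⟩ʳ a → suc (toℕ a) ℕ.+ suc (toℕ j) ≤ N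
    to a j (_ , w<) = proj₂ (inStaircase-⇔ a j)
      (≡.subst₂ Fin._<_ (≡.trans (w≈ (opposite j)) (Fin.opposite-involutive j)) (w≈ a) w<)
    from : ∀ a j → suc (toℕ a) ℕ.+ suc (toℕ j) ≤ N → a Fin.< opposite j × w ⟨$⟩ʳ opposite j Fin.< w ⟨$⟩ʳ a
    from a j le = proj₁ (inStaircase-⇔ j a) (≡.subst (_≤ N) (ℕ.+-comm (suc (toℕ a)) (suc (toℕ j))) le)
      , ≡.subst₂ Fin._<_ (≡.sym (≡.trans (w≈ (opposite j)) (Fin.opposite-involutive j))) (≡.sym (w≈ a))
          (proj₁ (inStaircase-⇔ a j) le)

  Z-longest : ∀ w → w Perm.≈ reverse → Z w ≈ β ^ ℓ w * staircase N
  Z-longest w w≈ = begin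
    Z w
      ≈⟨ partition-cong X₀ Y₀ (λ i → ≡.cong toℕ (w≈ i)) ⟩
    partition X₀ Y₀ (toℕ ∘ opposite)
      ≈⟨ grid-withoutFirst ℕ.≤-refl X₀ Y₀ none ⟩
    prod (λ i → prod (λ j → if toℕ j <ᵇ toℕ (opposite i) then X₀ i * Y₀ j - 1# else 1#)) * none (withoutFirst N N 0)
      ≈⟨ ≈-trans (*-cong ≈-refl (none-withoutFirst N 0)) (*-identityʳ _) ⟩
    prod (λ i → prod (λ j → if toℕ j <ᵇ toℕ (opposite i) then X₀ i * Y₀ j - 1# else 1#))
      ≈⟨ prod-cong (λ i → prod-cong (λ j → pointwise i j)) ⟩
    prod (λ i → prod (λ j → if does (inStaircase? (i , j)) then β * (x i ⊕ y j) else 1#))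
      ≈⟨ ∏.fold-cells (λ (i , j) → if does (inStaircase? (i , j)) then β * (x i ⊕ y j) else 1#) ⟨
    ∏ (map (λ (i , j) → if does (inStaircase? (i , j)) then β * (x i ⊕ y j) else 1#) (cells N))
      ≈⟨ ∏.fold-filter inStaircase? (λ (i , j) → β * (x i ⊕ y j)) (cells N) ⟨
    ∏ (map (λ (i , j) → β * (x i ⊕ y j)) staircaseCells)
      ≈⟨ ∏-scale β (λ (i , j) → x i ⊕ y j) staircaseCells ⟩
    β ^ length staircaseCells * staircase N
      ≡⟨ ≡.cong (λ k → β ^ k * staircase N) (≡.sym (ℓ-longest w w≈)) ⟩
    β ^ ℓ w * staircase N ∎
    where
    pointwise : ∀ i j → (if toℕ j <ᵇ toℕ (opposite i) then X₀ i * Y₀ j - 1# else 1#)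
                      ≈ (if does (inStaircase? (i , j)) then β * (x i ⊕ y j) else 1#)
    -- `_<ᵇ_` reduces on successors, as the recursion along a row requires; here it is exchanged for
    -- the decision that defines the staircase.
    pointwise i j rewrite does-⇔ (mk⇔ (proj₁ (inStaircase-⇔ i j)) (proj₂ (inStaircase-⇔ i j)))
                            (inStaircase? (i , j)) (toℕ j ℕ.<? toℕ (opposite i))
      with toℕ j <ᵇ toℕ (opposite i)
    ... | true  = X₀Y₀-1 i j
    ... | false = ≈-refl

  -- Induction on the chain of descents. The right side depends on `w` alone, so independence of the
  -- chosen chain comes out as well.
  grothendieck : ∀ {w : Permutation′ N} {f : Poly N} → IsGrothendieck w f → f ≈ β⁻¹ ^ ℓ w * Z w
  grothendieck {w} {f} (longest w≈ f≈) = begin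
    f                                     ≈⟨ f≈ ⟩
    staircase N                           ≈⟨ *-identityˡ _ ⟨
    1# * staircase N                      ≈⟨ *-cong (β⁻¹^*β^ (ℓ w)) ≈-refl ⟨
    β⁻¹ ^ ℓ w * β ^ ℓ w * staircase N     ≈⟨ *-assoc _ _ _ ⟩
    β⁻¹ ^ ℓ w * (β ^ ℓ w * staircase N)   ≈⟨ *-cong ≈-refl (Z-longest w w≈) ⟨
    β⁻¹ ^ ℓ w * Z w                       ∎
  grothendieck {v} {g} (descend {w} {f = f} {i = i} {j} adj w< isG v≈ g≈) = begin
    g                                     ≈⟨ g≈ ⟩
    π i j f                               ≈⟨ π-cong i j (grothendieck isG) ⟩
    π i j (β⁻¹ ^ ℓ w * Z w)               ≡⟨ ≡.cong (λ k → π i j (β⁻¹ ^ k * Z w)) (ℓ-descent a w v w< v≈) ⟩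
    π i j (β⁻¹ ^ suc (ℓ v) * Z w)         ≈⟨ π-Z a w v w< v≈ ⟩
    β⁻¹ ^ ℓ v * Z v                       ∎
    where
    a = adjacent i j adj

  -- The sum over bumpless pipe dreams

  ⟦⟧-∧ : ∀ a b → ⟦ a ∧ b ⟧ ≈ ⟦ a ⟧ * ⟦ b ⟧
  ⟦⟧-∧ true  b = ≈-sym (*-identityˡ _)
  ⟦⟧-∧ false b = ≈-sym (zeroˡ _)

  if-⟦⟧ : ∀ b (f : Poly N) → (if b then f else 0#) ≈ ⟦ b ⟧ * f
  if-⟦⟧ true  f = ≈-sym (*-identityˡ f)
  if-⟦⟧ false f = ≈-sym (zeroˡ f)

  ∑-scale : ∀ {A : Set} c (f : A → Poly N) as → ∑ (map (λ a → c * f a) as) ≈ c * ∑ (map f as)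
  ∑-scale c f []       = ≈-sym (zeroʳ c)
  ∑-scale c f (a ∷ as) = ≈-trans (+-cong ≈-refl (∑-scale c f as)) (≈-sym (distribˡ _ _ _))

  step-tiles : ∀ X Y l b f →
    ∑ (map (λ t → ⟦ does (fits? (is-just l) (is-just b) t) ⟧ * (tileWeight X Y t * f (propagate t l b))) tiles)
    ≈ ⟨ step X Y l b ⟩ f
  step-tiles X Y l b f = begin
    ∑ (map (λ t → ⟦ does (fit? t) ⟧ * term t) tiles)
      ≈⟨ ∑.fold-cong (λ t → if-⟦⟧ (does (fit? t)) (term t)) tiles ⟨
    ∑ (map (λ t → if does (fit? t) then term t else 0#) tiles)
      ≈⟨ ∑.fold-filter fit? term tiles ⟨
    ∑ (map term (filter fit? tiles))
      ≡⟨ ≡.cong ∑ (List.map-∘ (filter fit? tiles)) ⟩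
    ⟨ step X Y l b ⟩ f ∎
    where
    fit? = fits? (is-just l) (is-just b)
    term : Tile → Poly N
    term t = tileWeight X Y t * f (propagate t l b)

  rowWeight : ∀ {m} → Poly N → (Fin m → Poly N) → Vec Tile m → Poly N
  rowWeight X Y ts = prod (λ j → tileWeight X (Y j) (lookup ts j))

  gridWeight : ∀ {m n} → (Fin m → Poly N) → (Fin n → Poly N) → Vec (Vec Tile n) m → Poly N
  gridWeight X Y T = prod (λ i → rowWeight (X i) Y (lookup T i))

  -- Indicator and weight both split off the first tile; what remains is the same sum, started from
  -- the label passed on.
  row-expansion : ∀ {m} X (Y : Fin m → Poly N) l bs f →
    ∑ (map (λ ts → ⟦ does (rowConsistent? ts l bs) ⟧ * (rowWeight X Y ts * f (propagateRow ts l bs))) (vectors tiles m))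
    ≈ rowFunctional X Y l bs f
  row-expansion X Y l [] f = solve 1 (λ f → con 1 :* (con 1 :* f) :+ con 0 := f) ≈-refl _
  row-expansion {suc m} X Y l (b ∷ bs) f = begin
    ∑ (map F (cartesianProductWith _∷_ tiles (vectors tiles m)))
      ≈⟨ ∑.fold-cartesianProductWith F _∷_ tiles (vectors tiles m) ⟩
    ∑ (map (λ t → ∑ (map (λ ts → F (t ∷ ts)) (vectors tiles m))) tiles)
      ≈⟨ ∑.fold-cong per-tile tiles ⟩
    ∑ (map (λ t → ⟦ does (fits? (is-just l) (is-just b) t) ⟧ * (tileWeight X (Y zero) t * next (propagate t l b))) tiles)
      ≈⟨ step-tiles X (Y zero) l b next ⟩
    ⟨ step X (Y zero) l b ⟩ next ∎
    where
    F : Vec Tile (suc m) → Poly N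
    F ts = ⟦ does (rowConsistent? ts l (b ∷ bs)) ⟧ * (rowWeight X Y ts * f (propagateRow ts l (b ∷ bs)))
    next : Label × Label → Poly N
    next (r , u) = rowFunctional X (Y ∘ suc) r bs (λ (r′ , us) → f (r′ , u ∷ us))
    per-tile : ∀ t → ∑ (map (λ ts → F (t ∷ ts)) (vectors tiles m)) ≈
                     ⟦ does (fits? (is-just l) (is-just b) t) ⟧ * (tileWeight X (Y zero) t * next (propagate t l b))
    per-tile t = begin
      ∑ (map (λ ts → F (t ∷ ts)) (vectors tiles m))
        ≈⟨ ∑.fold-cong (λ ts → ≈-trans (*-cong (⟦⟧-∧ c _) ≈-refl)
             (solve 5 (λ a a′ e e′ g → a :* a′ :* (e :* e′ :* g) := a :* e :* (a′ :* (e′ :* g))) ≈-refl _ _ _ _ _))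
             (vectors tiles m) ⟩
      ∑ (map (λ ts → ⟦ c ⟧ * W * G ts) (vectors tiles m))
        ≈⟨ ∑-scale (⟦ c ⟧ * W) G (vectors tiles m) ⟩
      ⟦ c ⟧ * W * ∑ (map G (vectors tiles m))
        ≈⟨ *-cong ≈-refl (row-expansion X (Y ∘ suc) r bs (λ (r′ , us) → f (r′ , u ∷ us))) ⟩
      ⟦ c ⟧ * W * next (propagate t l b)
        ≈⟨ *-assoc _ _ _ ⟩
      ⟦ c ⟧ * (W * next (propagate t l b)) ∎
      where
      c = does (fits? (is-just l) (is-just b) t)
      W = tileWeight X (Y zero) t
      r u : Label
      r = proj₁ (propagate t l b)
      u = proj₂ (propagate t l b)
      G : Vec Tile m → Poly N
      G ts = ⟦ does (rowConsistent? ts r bs) ⟧ * (rowWeight X (Y ∘ suc) ts *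
        f (proj₁ (propagateRow ts r bs) , u ∷ proj₂ (propagateRow ts r bs)))

  grid-expansion : ∀ {m n} (X : Fin m → Poly N) (Y : Fin n → Poly N) bs f →
    ∑ (map (λ T → ⟦ does (gridConsistent? T bs) ⟧ * (gridWeight X Y T * f (propagateRows T bs))) (vectors (vectors tiles n) m))
    ≈ gridFunctional X Y bs f
  grid-expansion {zero} X Y bs f = solve 1 (λ f → con 1 :* (con 1 :* f) :+ con 0 := f) ≈-refl _
  grid-expansion {suc m} {n} X Y bs f = begin
    ∑ (map F (cartesianProductWith _∷_ rows (vectors rows m)))
      ≈⟨ ∑.fold-cartesianProductWith F _∷_ rows (vectors rows m) ⟩
    ∑ (map (λ R → ∑ (map (λ Rs → F (R ∷ Rs)) (vectors rows m))) rows)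
      -- The top row comes first in the vector but has to be summed innermost, because its
      -- consistency depends on the labels leaving the rows below.
      ≈⟨ ∑.fold-swap (λ R Rs → F (R ∷ Rs)) rows (vectors rows m) ⟩
    ∑ (map (λ Rs → ∑ (map (λ R → F (R ∷ Rs)) rows)) (vectors rows m))
      ≈⟨ ∑.fold-cong per-rest (vectors rows m) ⟩
    ∑ (map (λ Rs → ⟦ does (gridConsistent? Rs bs) ⟧ * (gridWeight (X ∘ suc) Y Rs * next (propagateRows Rs bs))) (vectors rows m))
      ≈⟨ grid-expansion (X ∘ suc) Y bs next ⟩
    gridFunctional (X ∘ suc) Y bs next ∎
    where
    rows = vectors tiles n
    F : Vec (Vec Tile n) (suc m) → Poly N
    F T = ⟦ does (gridConsistent? T bs) ⟧ * (gridWeight X Y T * f (propagateRows T bs))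
    next : Vec Label m × Vec Label n → Poly N
    next (rs , ms) = rowFunctional (X zero) Y nothing ms (λ (r , us) → f (r ∷ rs , us))
    per-rest : ∀ Rs → ∑ (map (λ R → F (R ∷ Rs)) rows) ≈
               ⟦ does (gridConsistent? Rs bs) ⟧ * (gridWeight (X ∘ suc) Y Rs * next (propagateRows Rs bs))
    per-rest Rs = begin
      ∑ (map (λ R → F (R ∷ Rs)) rows)
        ≈⟨ ∑.fold-cong (λ R → ≈-trans (*-cong (⟦⟧-∧ c _) ≈-refl)
             (solve 5 (λ a a′ e e′ g → a :* a′ :* (e′ :* e :* g) := a :* e :* (a′ :* (e′ :* g))) ≈-refl _ _ _ _ _)) rows ⟩
      ∑ (map (λ R → ⟦ c ⟧ * W * G R) rows)
        ≈⟨ ∑-scale (⟦ c ⟧ * W) G rows ⟩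
      ⟦ c ⟧ * W * ∑ (map G rows)
        ≈⟨ *-cong ≈-refl (row-expansion (X zero) Y nothing ms (λ (r , us) → f (r ∷ rs , us))) ⟩
      ⟦ c ⟧ * W * next (rs , ms)
        ≈⟨ *-assoc _ _ _ ⟩
      ⟦ c ⟧ * (W * next (rs , ms)) ∎
      where
      c = does (gridConsistent? Rs bs)
      W = gridWeight (X ∘ suc) Y Rs
      rs : Vec Label m
      rs = proj₁ (propagateRows Rs bs)
      ms : Vec Label n
      ms = proj₂ (propagateRows Rs bs)
      G : Vec Tile n → Poly N
      G R = ⟦ does (rowConsistent? R nothing ms) ⟧ * (rowWeight (X zero) Y R *
        f (proj₁ (propagateRow R nothing ms) ∷ rs , proj₂ (propagateRow R nothing ms)))

  -- The decision `d` is arbitrary, since equivalent propositions have equal `does`; it can then be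
  -- the one used by `Pipes`.
  matching-⟦⟧ : ∀ {m} (u : Fin m → ℕ) rs (d : Dec (∀ i → lookup rs i ≡ just (u i))) → matching u rs ≈ ⟦ does d ⟧
  matching-⟦⟧ u [] d rewrite dec-true d (λ ()) = ≈-refl
  matching-⟦⟧ u (r ∷ rs) d = begin
    (r is u zero) * matching (u ∘ suc) rs
      ≈⟨ *-cong ≈-refl (matching-⟦⟧ (u ∘ suc) rs tail?) ⟩
    (r is u zero) * ⟦ does tail? ⟧
      ≈⟨ ⟦⟧-∧ (does head?) (does tail?) ⟨
    ⟦ does (head? ×-dec tail?) ⟧
      ≡⟨ ≡.cong ⟦_⟧ (does-⇔ (mk⇔ (λ (h , t) → λ { zero → h ; (suc i) → t i }) (λ e → e zero , e ∘ suc)) (head? ×-dec tail?) d) ⟩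
    ⟦ does d ⟧ ∎
    where
    head? = Maybe.≡-dec ℕ._≟_ r (just (u zero))
    tail? = Fin.all? λ i → Maybe.≡-dec ℕ._≟_ (lookup rs i) (just (u (suc i)))

  none-⟦⟧ : ∀ {m} (ls : Vec Label m) (d : Dec (∀ j → is-just (lookup ls j) ≡ false)) → none ls ≈ ⟦ does d ⟧
  none-⟦⟧ [] d rewrite dec-true d (λ ()) = ≈-refl
  none-⟦⟧ (l ∷ ls) d = begin
    ⟦ does head? ⟧ * none ls
      ≈⟨ *-cong ≈-refl (none-⟦⟧ ls tail?) ⟩
    ⟦ does head? ⟧ * ⟦ does tail? ⟧
      ≈⟨ ⟦⟧-∧ (does head?) (does tail?) ⟨
    ⟦ does (head? ×-dec tail?) ⟧
      ≡⟨ ≡.cong ⟦_⟧ (does-⇔ (mk⇔ (λ (h , t) → λ { zero → h ; (suc i) → t i }) (λ e → e zero , e ∘ suc)) (head? ×-dec tail?) d) ⟩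
    ⟦ does d ⟧ ∎
    where
    head? = is-just l Bool.≟ false
    tail? = Fin.all? λ j → is-just (lookup ls j) Bool.≟ false

  -- Both products extend to all cells with factor 1 elsewhere, and a tile is counted by at most one
  -- of them.
  wt-gridWeight : ∀ T → wt T ≈ gridWeight X₀ Y₀ T
  wt-gridWeight T = begin
    ∏ (map b (D T)) * ∏ (map e (U T))
      ≈⟨ *-cong (∏.fold-filter blank? b (cells N)) (∏.fold-filter upElbow? e (cells N)) ⟩
    ∏ (map (λ c → if does (blank? c) then b c else 1#) (cells N))
    * ∏ (map (λ c → if does (upElbow? c) then e c else 1#) (cells N))
      ≈⟨ ∏.fold-distrib _ _ (cells N) ⟨
    ∏ (map (λ c → (if does (blank? c) then b c else 1#) * (if does (upElbow? c) then e c else 1#)) (cells N))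
      ≈⟨ ∏.fold-cong (λ (i , j) → per-cell i j (T at i , j)) (cells N) ⟩
    ∏ (map (λ (i , j) → tileWeight (X₀ i) (Y₀ j) (T at i , j)) (cells N))
      ≈⟨ ∏.fold-cells (λ (i , j) → tileWeight (X₀ i) (Y₀ j) (T at i , j)) ⟩
    gridWeight X₀ Y₀ T ∎
    where
    b e : Fin N × Fin N → Poly N
    b (i , j) = β * (x i ⊕ y j)
    e (i , j) = 1# + β * (x i ⊕ y j)
    blank? : Decidable (λ ((i , j) : Fin N × Fin N) → (T at i , j) ≡ blank)
    blank? (i , j) = (T at i , j) ≟ᵗ blank
    upElbow? : Decidable (λ ((i , j) : Fin N × Fin N) → (T at i , j) ≡ upElbow)
    upElbow? (i , j) = (T at i , j) ≟ᵗ upElbow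
    per-cell : ∀ i j t → (if does (t ≟ᵗ blank) then b (i , j) else 1#) * (if does (t ≟ᵗ upElbow) then e (i , j) else 1#)
               ≈ tileWeight (X₀ i) (Y₀ j) t
    per-cell i j downElbow  = *-identityˡ 1#
    per-cell i j upElbow    = solve 3 (λ a b c → let o = con 1 in
      o :* (o :+ c :* (a :+ b :+ c :* a :* b)) := (o :+ c :* a) :* (o :+ c :* b)) ≈-refl (x i) (y j) β
    per-cell i j crossing   = *-identityˡ 1#
    per-cell i j blank      = ≈-trans (*-identityʳ _) (≈-sym (X₀Y₀-1 i j))
    per-cell i j horizontal = *-identityˡ 1#
    per-cell i j vertical   = *-identityˡ 1#

  ∑-Pipes : ∀ w → ∑ (map wt (Pipes w)) ≈ Z w
  ∑-Pipes w = begin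
    ∑ (map wt (Pipes w))
      ≈⟨ ∑.fold-filter pipe? wt (tilings N) ⟩
    ∑ (map (λ T → if does (pipe? T) then wt T else 0#) (tilings N))
      ≈⟨ ∑.fold-cong per-tiling (tilings N) ⟩
    ∑ (map (λ T → ⟦ does (gridConsistent? T bs) ⟧ * (gridWeight X₀ Y₀ T * end (propagateRows T bs))) (tilings N))
      ≈⟨ grid-expansion X₀ Y₀ bs end ⟩
    gridFunctional X₀ Y₀ bs end
      ≡⟨ ≡.cong (λ bs → gridFunctional X₀ Y₀ bs end) (≡.sym (labels-tabulate N 0)) ⟩
    Z w ∎
    where
    bs = allPresent N
    u : Fin N → ℕ
    u i = toℕ (w ⟨$⟩ʳ i)
    end : Vec Label N × Vec Label N → Poly N
    end (rs , ts) = matching u rs * none ts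
    pipe? : Decidable (λ T → IsBPD T × HasDemazureProduct w T)
    pipe? T = isBPD? T ×-dec hasDemazureProduct? w T
    matching? : ∀ T → Dec (∀ i → lookup (proj₁ (propagateRows T bs)) i ≡ just (u i))
    matching? T = hasDemazureProduct? w T
    none? : ∀ T → Dec (∀ j → is-just (lookup (proj₂ (propagateRows T bs)) j) ≡ false)
    none? T = Fin.all? λ j → is-just (lookup (proj₂ (propagateRows T bs)) j) Bool.≟ false
    emerging? : Decidable (Emerging u)
    emerging? T = gridConsistent? T bs ×-dec (matching? T ×-dec none? T)
    per-tiling : ∀ T → (if does (pipe? T) then wt T else 0#)
                 ≈ ⟦ does (gridConsistent? T bs) ⟧ * (gridWeight X₀ Y₀ T * end (propagateRows T bs))
    per-tiling T = begin
      (if does (pipe? T) then wt T else 0#)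
        ≈⟨ if-⟦⟧ (does (pipe? T)) (wt T) ⟩
      ⟦ does (pipe? T) ⟧ * wt T
        ≡⟨ ≡.cong (λ b → ⟦ b ⟧ * wt T) (does-⇔ (mk⇔ (pipe⇒emerging w T) (emerging⇒pipe w T)) (pipe? T) (emerging? T)) ⟩
      ⟦ does (emerging? T) ⟧ * wt T
        ≈⟨ *-cong (≈-trans (⟦⟧-∧ (does (gridConsistent? T bs)) _) (*-cong ≈-refl (⟦⟧-∧ (does (matching? T)) (does (none? T)))))
             (wt-gridWeight T) ⟩
      ⟦ does (gridConsistent? T bs) ⟧ * (⟦ does (matching? T) ⟧ * ⟦ does (none? T) ⟧) * gridWeight X₀ Y₀ T
        ≈⟨ *-cong (*-cong ≈-refl (*-cong (matching-⟦⟧ u _ (matching? T)) (none-⟦⟧ _ (none? T)))) ≈-refl ⟨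
      ⟦ does (gridConsistent? T bs) ⟧ * end (propagateRows T bs) * gridWeight X₀ Y₀ T
        ≈⟨ solve 3 (λ a b c → a :* b :* c := a :* (c :* b)) ≈-refl _ _ _ ⟩
      ⟦ does (gridConsistent? T bs) ⟧ * (gridWeight X₀ Y₀ T * end (propagateRows T bs)) ∎

theorem1p1 : (n : ℕ) → 1 ≤ n → (w : Permutation′ n) → (𝔊 : Poly n) → IsGrothendieck w 𝔊 → 𝔊 ≈ β⁻¹ ^ ℓ w * ∑ (map wt (Pipes w))
theorem1p1 n 1≤n w 𝔊 isG = ≈-trans (grothendieck isG) (*-cong ≈-refl (≈-sym (∑-Pipes w)))
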